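{- Let $G$ be an abelian group. Then the following are equivalent: (1) $G$ has a connected Cayley graph that is not CCA. (2) $G$ has a connected Cayley graph that is not strongly CCA. (3) $G$ has a subgroup $H$ such that either $G \cong H \oplus \mathbb{Z}_4 \oplus \mathbb{Z}_2$, or $G \cong H \oplus \mathbb{Z}_2 \oplus \mathbb{Z}_2$ and $H$ has an element of order $4$. (4) $G$ has a subgroup $H$ such that either $G \cong H \oplus \mathbb{Z}_4 \oplus \mathbb{Z}_2$, or $G \cong H \oplus \mathbb{Z}_2 \oplus \mathbb{Z}_2$ and $H$ has an element of order $8$.
   Context: Groups are abelian, written additively, and may be infinite; $\mathbb{Z}_n$ is the cyclic group of order $n$. A Cayley graph of $G$ is a graph $\operatorname{Cay}(G;S)$, where $S$ is a subset of $G$ with $S = -S$ ($S$ is not required to be finite): it is the undirected graph whose vertices are the elements of $G$, with an edge joining $g$ and $g+s$ for all $g \in G$ and $s \in S$. (It is connected if and only if $S$ generates $G$.) An automorphism $\varphi$ of $\operatorname{Cay}(G;S)$ is colour-preserving if $\varphi(g+s) \in \{\varphi(g) \pm s\}$ for all $g \in G$ and $s \in S$. An automorphism $\varphi$ of $\operatorname{Cay}(G;S)$ is colour-permuting if there is a bijection $\pi \colon S \to S$ such that $\varphi(g+s) \in \{\varphi(g) \pm \pi(s)\}$ for all $g \in G$ and $s \in S$. A bijection $\varphi \colon G \to G$ is affine if there are a group automorphism $\tau$ of $G$ and an element $b \in G$ such that $\varphi(x) = \tau(x) + b$ for all $x \in G$. The graph $\operatorname{Cay}(G;S)$ is CCA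 if every colour-preserving automorphism of it is affine, and strongly CCA if every colour-permuting automorphism of it is affine. -}

module Defs where

open import Algebra.Bundles using (AbelianGroup)
import Algebra.Construct.DirectProduct as DirectProduct
import Algebra.Definitions.RawMonoid as RawMonoidDefinitions
open import Algebra.Morphism.Structures using (module GroupMorphisms)
import Algebra.Properties.AbelianGroup as AbelianGroupProperties
open import Data.Fin.Base using (Fin; toℕ)
open import Data.Fin.Properties using (toℕ<n; toℕ-fromℕ<; toℕ-injective)
open import Data.Nat.Base as ℕ using (ℕ; suc; NonZero)
open import Data.Nat.DivMod
  using (_%_; _mod_; %-distribˡ-+; m%n%n≡m%n; m<n⇒m%n≡m; m%n<n; n%n≡0)
import Data.Nat.Properties as ℕ
open import Data.Product.Base using (_×_; _,_; Σ-syntax; ∃-syntax; proj₁; proj₂)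
open import Data.Sum.Base using (_⊎_)
open import Function.Bundles using (Bijection; Func; Surjection; _⇔_)
open import Level using (Level; 0ℓ; _⊔_) renaming (suc to lsuc)
open import Relation.Binary.Bundles using (Setoid)
open import Relation.Binary.Construct.Closure.ReflexiveTransitive using (Star)
import Relation.Binary.Construct.On as On
open import Relation.Binary.Construct.Union using (_∪_)
open import Relation.Binary.Core using (Rel)
open import Relation.Binary.Definitions using (Symmetric; _Respects_; _Respects₂_)
open import Relation.Binary.PropositionalEquality
  using (_≡_; refl; sym; trans; cong; cong₂; isEquivalence; module ≡-Reasoning)
open import Relation.Nullary.Negation.Core using (¬_)
open import Relation.Unary using (Pred)

private
  variable
    a b c c₁ c₂ e ℓ ℓ₁ ℓ₂ p : Level

------------------------------------------------------------------------
-- The axiom of choice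

-- Every surjection splits.  The function underlying `Surjection.surjective`
-- need not respect the equality of B; the section asserted here must.

AxiomOfChoice : (a b ℓ₁ ℓ₂ : Level) → Set (lsuc (a ⊔ b ⊔ ℓ₁ ⊔ ℓ₂))
AxiomOfChoice a b ℓ₁ ℓ₂ =
  {A : Setoid a ℓ₁} {B : Setoid b ℓ₂} (f : Surjection A B) →
  Σ[ s ∈ Func B A ]
    (∀ y → Setoid._≈_ B (Surjection.to f (Func.to s y)) y)

------------------------------------------------------------------------
-- Graphs

record Graph c ℓ e : Set (lsuc (c ⊔ ℓ ⊔ e)) where
  field
    vertices : Setoid c ℓ

  open Setoid vertices public using () renaming (Carrier to Vertex)
  open Setoid vertices using (_≈_)

  field
    Adj      : Rel Vertex e
    Adj-sym  : Symmetric Adj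
    Adj-resp : Adj Respects₂ _≈_

-- `_≈_` is added to the steps so that equal vertices are joined by a walk
-- even when their representatives differ.

Connected : Graph c ℓ e → Set (c ⊔ ℓ ⊔ e)
Connected Γ = ∀ g h → Star (_≈_ ∪ Adj) g h
  where
  open Graph Γ
  open Setoid vertices using (_≈_)

record Automorphism (Γ : Graph c ℓ e) : Set (c ⊔ ℓ ⊔ e) where
  open Graph Γ
  field
    bijection : Bijection vertices vertices

  open Bijection bijection public using (to)

  field
    adj-iff : ∀ g h → Adj g h ⇔ Adj (to g) (to h)

------------------------------------------------------------------------
-- Abelian groups

infix 4 _≅_

_≅_ : AbelianGroup c₁ ℓ₁ → AbelianGroup c₂ ℓ₂ → Set (c₁ ⊔ c₂ ⊔ ℓ₁ ⊔ ℓ₂)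
G ≅ H = ∃[ f ] IsGroupIsomorphism f
  where
  open GroupMorphisms (AbelianGroup.rawGroup G) (AbelianGroup.rawGroup H)

infixr 6 _⊕_

_⊕_ : AbelianGroup c₁ ℓ₁ → AbelianGroup c₂ ℓ₂ → AbelianGroup (c₁ ⊔ c₂) (ℓ₁ ⊔ ℓ₂)
_⊕_ = DirectProduct.abelianGroup

HasOrder : (G : AbelianGroup c ℓ) → AbelianGroup.Carrier G → ℕ → Set ℓ
HasOrder G x n =
  0 ℕ.< n × n · x ≈ ε × (∀ m → 0 ℕ.< m → m ℕ.< n → ¬ (m · x ≈ ε))
  where
  open AbelianGroup G
  open RawMonoidDefinitions rawMonoid using () renaming (_×_ to infixr 8 _·_)

HasElementOfOrder : AbelianGroup c ℓ → ℕ → Set (c ⊔ ℓ)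
HasElementOfOrder G n = ∃[ x ] HasOrder G x n

record Subgroup (G : AbelianGroup c ℓ) (p : Level) : Set (c ⊔ ℓ ⊔ lsuc p) where
  open AbelianGroup G
  field
    mem      : Pred Carrier p
    mem-resp : mem Respects _≈_
    mem-ε    : mem ε
    mem-∙    : ∀ {x y} → mem x → mem y → mem (x ∙ y)
    mem-⁻¹   : ∀ {x} → mem x → mem (x ⁻¹)

  abelianGroup : AbelianGroup (c ⊔ p) ℓ
  abelianGroup = record
    { Carrier = Σ[ x ∈ Carrier ] mem x
    ; _≈_     = λ x y → proj₁ x ≈ proj₁ y
    ; _∙_     = λ x y → (proj₁ x ∙ proj₁ y) , mem-∙ (proj₂ x) (proj₂ y)
    ; ε       = ε , mem-ε
    ; _⁻¹     = λ x → (proj₁ x ⁻¹) , mem-⁻¹ (proj₂ x)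
    ; isAbelianGroup = record
      { isGroup = record
        { isMonoid = record
          { isSemigroup = record
            { isMagma = record
              { isEquivalence = On.isEquivalence proj₁ (Setoid.isEquivalence setoid)
              ; ∙-cong        = ∙-cong
              }
            ; assoc = λ x y z → assoc (proj₁ x) (proj₁ y) (proj₁ z)
            }
          ; identity = (λ x → identityˡ (proj₁ x)) , (λ x → identityʳ (proj₁ x))
          }
        ; inverse = (λ x → inverseˡ (proj₁ x)) , (λ x → inverseʳ (proj₁ x))
        ; ⁻¹-cong = ⁻¹-cong
        }
      ; comm = λ x y → comm (proj₁ x) (proj₁ y)
      }
    }

module _ (n : ℕ) .{{_ : NonZero n}} where

  private
    _+ₙ_ : Fin n → Fin n → Fin n
    i +ₙ j = (toℕ i ℕ.+ toℕ j) mod n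

    0ₙ : Fin n
    0ₙ = 0 mod n

    -ₙ_ : Fin n → Fin n
    -ₙ i = (n ℕ.∸ toℕ i) mod n

    toℕ-mod : ∀ k → toℕ (k mod n) ≡ k % n
    toℕ-mod k = toℕ-fromℕ< (m%n<n k n)

    toℕ-% : ∀ (i : Fin n) → toℕ i % n ≡ toℕ i
    toℕ-% i = m<n⇒m%n≡m (toℕ<n i)

    mod-cong : ∀ {k l} → k % n ≡ l % n → k mod n ≡ l mod n
    mod-cong {k} {l} eq =
      toℕ-injective (trans (toℕ-mod k) (trans eq (sym (toℕ-mod l))))

    mod-toℕ : ∀ i → toℕ i mod n ≡ i
    mod-toℕ i = toℕ-injective (trans (toℕ-mod (toℕ i)) (toℕ-% i))

    open ≡-Reasoning

    mod-+ˡ : ∀ k l → (toℕ (k mod n) ℕ.+ l) mod n ≡ (k ℕ.+ l) mod n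
    mod-+ˡ k l = mod-cong (begin
      (toℕ (k mod n) ℕ.+ l) % n      ≡⟨ cong (λ m → (m ℕ.+ l) % n) (toℕ-mod k) ⟩
      (k % n ℕ.+ l) % n              ≡⟨ %-distribˡ-+ (k % n) l n ⟩
      (k % n % n ℕ.+ l % n) % n      ≡⟨ cong (λ m → (m ℕ.+ l % n) % n) (m%n%n≡m%n k n) ⟩
      (k % n ℕ.+ l % n) % n          ≡⟨ %-distribˡ-+ k l n ⟨
      (k ℕ.+ l) % n                  ∎)

    comm : ∀ i j → i +ₙ j ≡ j +ₙ i
    comm i j = cong (_mod n) (ℕ.+-comm (toℕ i) (toℕ j))

    assoc : ∀ i j k → (i +ₙ j) +ₙ k ≡ i +ₙ (j +ₙ k)
    assoc i j k = begin
      (i +ₙ j) +ₙ k                              ≡⟨ mod-+ˡ (toℕ i ℕ.+ toℕ j) (toℕ k) ⟩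
      (toℕ i ℕ.+ toℕ j ℕ.+ toℕ k) mod n          ≡⟨ cong (_mod n) (ℕ.+-assoc (toℕ i) (toℕ j) (toℕ k)) ⟩
      (toℕ i ℕ.+ (toℕ j ℕ.+ toℕ k)) mod n        ≡⟨ cong (_mod n) (ℕ.+-comm (toℕ i) _) ⟩
      (toℕ j ℕ.+ toℕ k ℕ.+ toℕ i) mod n          ≡⟨ mod-+ˡ (toℕ j ℕ.+ toℕ k) (toℕ i) ⟨
      (j +ₙ k) +ₙ i                              ≡⟨ comm (j +ₙ k) i ⟩
      i +ₙ (j +ₙ k)                              ∎

    identityˡ : ∀ i → 0ₙ +ₙ i ≡ i
    identityˡ i = trans (mod-+ˡ 0 (toℕ i)) (mod-toℕ i)

    inverseˡ : ∀ i → (-ₙ i) +ₙ i ≡ 0ₙ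
    inverseˡ i = begin
      (-ₙ i) +ₙ i                         ≡⟨ mod-+ˡ (n ℕ.∸ toℕ i) (toℕ i) ⟩
      (n ℕ.∸ toℕ i ℕ.+ toℕ i) mod n       ≡⟨ cong (_mod n) (ℕ.m∸n+n≡m (ℕ.<⇒≤ (toℕ<n i))) ⟩
      n mod n                             ≡⟨ mod-cong (trans (n%n≡0 n) (sym (m<n⇒m%n≡m (ℕ.>-nonZero⁻¹ n)))) ⟩
      0 mod n                             ∎

  ℤ/ : AbelianGroup 0ℓ 0ℓ
  ℤ/ = record
    { Carrier = Fin n
    ; _≈_     = _≡_
    ; _∙_     = _+ₙ_
    ; ε       = 0ₙ
    ; _⁻¹     = -ₙ_
    ; isAbelianGroup = record
      { isGroup = record
        { isMonoid = record
          { isSemigroup = record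
            { isMagma = record { isEquivalence = isEquivalence ; ∙-cong = cong₂ _+ₙ_ }
            ; assoc = assoc
            }
          ; identity = identityˡ , λ i → trans (comm i 0ₙ) (identityˡ i)
          }
        ; inverse = inverseˡ , λ i → trans (comm i (-ₙ i)) (inverseˡ i)
        ; ⁻¹-cong = cong -ₙ_
        }
      ; comm = comm
      }
    }

------------------------------------------------------------------------
-- Cayley graphs

-- Closure under negation gives S = - S, since negation is an involution.

record ConnectionSet (G : AbelianGroup c ℓ) (p : Level) : Set (c ⊔ ℓ ⊔ lsuc p) where
  open AbelianGroup G renaming (_⁻¹ to infix 8 -_)
  field
    mem      : Pred Carrier p
    mem-resp : mem Respects _≈_
    mem-neg  : ∀ {s} → mem s → mem (- s)

  elements : Setoid (c ⊔ p) ℓ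
  elements = record
    { Carrier       = Σ[ s ∈ Carrier ] mem s
    ; _≈_           = λ s t → proj₁ s ≈ proj₁ t
    ; isEquivalence = On.isEquivalence proj₁ (Setoid.isEquivalence setoid)
    }

module _ (G : AbelianGroup c ℓ) where

  open AbelianGroup G
    renaming (_∙_ to infixl 6 _+_; _⁻¹ to infix 8 -_; sym to ≈-sym; trans to ≈-trans)
    hiding (refl)
  open AbelianGroupProperties G using (xyx⁻¹≈y)

  Cay : ConnectionSet G p → Graph c ℓ (c ⊔ ℓ ⊔ p)
  Cay S = record
    { vertices = setoid
    ; Adj      = λ g h → ∃[ s ] (mem s × h ≈ g + s)
    ; Adj-sym  = λ {g} {h} (s , s∈S , h≈g+s) →
        - s , mem-neg s∈S ,
        ≈-sym (≈-trans (∙-congʳ h≈g+s)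
          (≈-trans (assoc g s (- s)) (≈-trans (∙-congˡ (inverseʳ s)) (identityʳ g))))
    ; Adj-resp =
        (λ h≈h′ (s , s∈S , h≈g+s) → s , s∈S , ≈-trans (≈-sym h≈h′) h≈g+s) ,
        (λ g≈g′ (s , s∈S , h≈g+s) → s , s∈S , ≈-trans h≈g+s (∙-congʳ g≈g′))
    }
    where open ConnectionSet S

  module _ (S : ConnectionSet G p) where

    open ConnectionSet S

    ColourPreserving : Automorphism (Cay S) → Set (c ⊔ ℓ ⊔ p)
    ColourPreserving φ =
      ∀ g s → mem s →
        (to (g + s) ≈ to g + s) ⊎ (to (g + s) ≈ to g + - s)
      where open Automorphism φ

    ColourPermuting : Automorphism (Cay S) → Set (c ⊔ ℓ ⊔ p)
    ColourPermuting φ =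
      Σ[ π ∈ Bijection elements elements ]
        (∀ g s (s∈S : mem s) → let πs = proj₁ (Bijection.to π (s , s∈S)) in
          (to (g + s) ≈ to g + πs) ⊎ (to (g + s) ≈ to g + - πs))
      where open Automorphism φ

  Affine : (Carrier → Carrier) → Set (c ⊔ ℓ)
  Affine f = ∃[ τ ] ∃[ t ] (IsGroupIsomorphism τ × (∀ x → f x ≈ τ x + t))
    where open GroupMorphisms rawGroup rawGroup

  IsCCA : ConnectionSet G p → Set (c ⊔ ℓ ⊔ p)
  IsCCA S = ∀ φ → ColourPreserving S φ → Affine (Automorphism.to φ)

  IsStronglyCCA : ConnectionSet G p → Set (c ⊔ ℓ ⊔ p)
  IsStronglyCCA S = ∀ φ → ColourPermuting S φ → Affine (Automorphism.to φ)

{-# OPTIONS --safe #-}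
module Submission where

open import Defs
open import Algebra.Bundles using (AbelianGroup; CommutativeMonoid; CommutativeRing)
open import Algebra.Morphism.Structures using (module GroupMorphisms)
import Algebra.Properties.AbelianGroup as AbelianGroupProperties
import Algebra.Properties.CommutativeMonoid.Mult as Mult
import Algebra.Properties.CommutativeSemigroup as CommutativeSemigroupProperties
open import Axiom.ExcludedMiddle using (ExcludedMiddle)
open import Data.Bool.Base using (Bool; true; false; _∧_; _xor_; if_then_else_; not)
import Data.Bool.Properties as Bool
open import Data.Bool.Properties using (xor-same; xor-identityʳ)
open import Data.Empty using (⊥-elim)
open import Data.Fin.Base using (Fin; zero; suc; toℕ)
import Data.Fin.Properties as Fin
open import Data.Nat.Base as ℕ using (ℕ; zero; suc; nonZero; s≤s; z≤n; _≤_; _<_)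
open import Data.Nat.DivMod
  using (_%_; _/_; _mod_; m≡m%n+[m/n]*n; %-distribˡ-+; m%n%n≡m%n; m<n⇒m%n≡m; m%n<n)
import Data.Nat.Properties as ℕ
open import Data.Product.Base using (_×_; _,_; Σ-syntax; ∃-syntax; proj₁; proj₂)
open import Data.Sum.Base using (_⊎_; inj₁; inj₂; [_,_]′)
open import Data.Vec.Base using (Vec; []; _∷_; lookup; zipWith; replicate)
open import Function.Base using (_∘_)
open import Function.Bundles using (_⇔_; Bijection; Func; mk⇔)
import Function.Construct.Identity as Identity
open import Level using (Level; Lift; lift; _⊔_; 0ℓ) renaming (suc to lsuc)
open import Relation.Binary.Bundles using (Preorder; Setoid)
open import Relation.Binary.Construct.Closure.ReflexiveTransitive using (Star; _◅_)
open import Relation.Binary.Construct.Union using (_∪_)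
open import Relation.Binary.Definitions using (_Respects_)
open import Relation.Binary.PropositionalEquality as ≡ using (_≡_)
import Relation.Binary.Reasoning.Setoid as ≈-Reasoning
import Relation.Binary.Reflection as Reflection
open import Relation.Nullary.Decidable.Core
  using (yes; no; True; toWitness; fromWitness; decidable-stable)
open import Relation.Nullary.Negation.Core using (¬_; contradiction)
open import Relation.Unary using (Pred)

private
  variable
    a b c ℓ r p : Level

-- The implication (2) ⇒ (4) passes through condition (5): there are u, v with 2u = 2v ≠ 0 = 4u which are
-- linearly independent modulo 2G.
--
-- For a colour-permuting φ put δ s g = φ(g + s) - φ(g) ∈ {± π(s)}. If every δ s is constant, φ is
-- affine. In general 2 δ s is constant, so φ(g + 2x) - φ(g) does not depend on g, and hence
-- δ s is constant on cosets of 2G. If δ s changes along an edge of colour t, comparing the sides of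
-- a square makes s and t elements of order 4 with 2s = 2t, and invariance under 2G makes them
-- independent; involutions that π sends to elements of order 4 need a separate argument.
--
-- Under (5) the elements u and w = u - v yield homomorphisms onto ℤ/4 or ℤ/2 that split, hence (4).
-- A homomorphism is obtained from a subgroup that is maximal among those avoiding an element.
--
-- Conversely, (3) yields u, v together with homomorphisms α, β to ℤ/2 dual to them, and then
-- g ↦ g + α(g)β(g)2u is a colour-preserving automorphism which is not affine.

-- The obstacle is that π need not respect orders. Injectivity of φ keeps δ s unchanged along an
-- edge of its own colour unless 2s = 0; along an involution s it changes sign at every step, which
-- is no contradiction when π(s) has order 4. Changes of sign cannot be excluded, so they are
-- confined to places where 4 δ s g = 0, and there they do not affect 2 δ s.
--
-- On the other side, an infinite G need not decompose into cyclic summands. If M is maximal among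
-- the subgroups avoiding t, then every nonzero subgroup of G / M contains the image of t. Once G /
-- M has exponent 2 or 4 this forces it to be cyclic, so Zorn's lemma is applied above nG with n = 2
-- or 4, enlarged by the generator that the homomorphism has to kill.
--
-- The 8 in (4) comes from divisibility: a cyclic summand of order 4 generated by u needs 2u outside
-- 4G, and a solution y of 2u = 4y has order 8.

-- Linear identities in abelian groups

module AbelianGroupSolver (G : AbelianGroup c ℓ) where

  open AbelianGroup G
  open AbelianGroupProperties G
  open Mult commutativeMonoid using (×-homo-+; ×-congˡ) renaming (_×_ to infixr 8 _·_)
  open CommutativeSemigroupProperties commutativeSemigroup using (interchange)
  open ≈-Reasoning setoid

  infixl 6 _⊞_
  infix 8 ⊟_

  data Expr (n : ℕ) : Set where
    var : Fin n → Expr n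
    𝟘   : Expr n
    _⊞_ : Expr n → Expr n → Expr n
    ⊟_  : Expr n → Expr n

  ⟦_⟧ : ∀ {n} → Expr n → Vec Carrier n → Carrier
  ⟦ var i ⟧ ρ = lookup ρ i
  ⟦ 𝟘 ⟧     ρ = ε
  ⟦ e ⊞ f ⟧ ρ = ⟦ e ⟧ ρ ∙ ⟦ f ⟧ ρ
  ⟦ ⊟ e ⟧   ρ = ⟦ e ⟧ ρ ⁻¹

  combination : ∀ {n} → Vec ℕ n → Vec Carrier n → Carrier
  combination []       []       = ε
  combination (k ∷ ks) (x ∷ xs) = k · x ∙ combination ks xs

  unit : ∀ {n} → Fin n → Vec ℕ n
  unit zero    = 1 ∷ replicate _ 0
  unit (suc i) = 0 ∷ unit i

  -- Integer coefficients are kept as a pair of natural ones standing for their difference, so that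
  -- negation merely swaps the halves.
  positive negative : ∀ {n} → Expr n → Vec ℕ n
  positive (var i) = unit i
  positive 𝟘       = replicate _ 0
  positive (e ⊞ f) = zipWith ℕ._+_ (positive e) (positive f)
  positive (⊟ e)   = negative e
  negative (var i) = replicate _ 0
  negative 𝟘       = replicate _ 0
  negative (e ⊞ f) = zipWith ℕ._+_ (negative e) (negative f)
  negative (⊟ e)   = positive e

  -- The truncated subtractions cancel what the two halves have in common.
  ⟦_⇓⟧ : ∀ {n} → Expr n → Vec Carrier n → Carrier
  ⟦ e ⇓⟧ ρ = combination (zipWith ℕ._∸_ (positive e) (negative e)) ρ
           ∙ combination (zipWith ℕ._∸_ (negative e) (positive e)) ρ ⁻¹

  combination-0 : ∀ {n} (ρ : Vec Carrier n) → combination (replicate n 0) ρ ≈ ε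
  combination-0 []      = refl
  combination-0 (x ∷ ρ) = trans (identityˡ _) (combination-0 ρ)

  combination-unit : ∀ {n} (i : Fin n) ρ → combination (unit i) ρ ≈ lookup ρ i
  combination-unit zero    (x ∷ ρ) =
    trans (∙-cong (identityʳ x) (combination-0 ρ)) (identityʳ x)
  combination-unit (suc i) (x ∷ ρ) = trans (identityˡ _) (combination-unit i ρ)

  combination-+ : ∀ {n} (ks ls : Vec ℕ n) ρ →
    combination (zipWith ℕ._+_ ks ls) ρ ≈ combination ks ρ ∙ combination ls ρ
  combination-+ []       []       []      = sym (identityˡ ε)
  combination-+ (k ∷ ks) (l ∷ ls) (x ∷ ρ) =
    trans (∙-cong (×-homo-+ x k l) (combination-+ ks ls ρ)) (interchange _ _ _ _)

  ∸-+-swap : ∀ k l → (k ℕ.∸ l) ℕ.+ l ≡ (l ℕ.∸ k) ℕ.+ k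
  ∸-+-swap zero    zero    = ≡.refl
  ∸-+-swap zero    (suc l) = ≡.sym (ℕ.+-identityʳ _)
  ∸-+-swap (suc k) zero    = ℕ.+-identityʳ _
  ∸-+-swap (suc k) (suc l) = ≡.trans (ℕ.+-suc _ l)
    (≡.trans (≡.cong suc (∸-+-swap k l)) (≡.sym (ℕ.+-suc _ k)))

  combination-∸ : ∀ {n} (ks ls : Vec ℕ n) ρ →
    combination (zipWith ℕ._∸_ ks ls) ρ ∙ combination ls ρ ≈
    combination (zipWith ℕ._∸_ ls ks) ρ ∙ combination ks ρ
  combination-∸ []       []       []      = refl
  combination-∸ (k ∷ ks) (l ∷ ls) (x ∷ ρ) = trans (interchange _ _ _ _) (trans
    (∙-cong
      (trans (sym (×-homo-+ x (k ℕ.∸ l) l))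
        (trans (×-congˡ (∸-+-swap k l)) (×-homo-+ x (l ℕ.∸ k) k)))
      (combination-∸ ks ls ρ))
    (interchange _ _ _ _))

  difference-unique : ∀ {p q p′ q′} → p ∙ q′ ≈ p′ ∙ q → p ∙ q ⁻¹ ≈ p′ ∙ q′ ⁻¹
  difference-unique {p} {q} {p′} {q′} eq = ∙-cancelʳ q′ _ _ (begin
    p ∙ q ⁻¹ ∙ q′     ≈⟨ assoc _ _ _ ⟩
    p ∙ (q ⁻¹ ∙ q′)   ≈⟨ ∙-congˡ (comm _ _) ⟩
    p ∙ (q′ ∙ q ⁻¹)   ≈⟨ assoc _ _ _ ⟨
    p ∙ q′ ∙ q ⁻¹     ≈⟨ ∙-congʳ eq ⟩
    p′ ∙ q ∙ q ⁻¹     ≈⟨ //-rightDividesʳ q p′ ⟩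
    p′                ≈⟨ //-rightDividesˡ q′ p′ ⟨
    p′ ∙ q′ ⁻¹ ∙ q′   ∎)

  halves : ∀ {n} (e : Expr n) ρ →
    combination (positive e) ρ ∙ combination (negative e) ρ ⁻¹ ≈ ⟦ e ⟧ ρ
  halves (var i) ρ = trans
    (∙-cong (combination-unit i ρ) (trans (⁻¹-cong (combination-0 ρ)) ε⁻¹≈ε)) (identityʳ _)
  halves 𝟘       ρ = inverseʳ _
  halves (e ⊞ f) ρ = trans
    (∙-cong (combination-+ (positive e) (positive f) ρ)
      (trans (⁻¹-cong (combination-+ (negative e) (negative f) ρ)) (sym (⁻¹-∙-comm _ _))))
    (trans (interchange _ _ _ _) (∙-cong (halves e ρ) (halves f ρ)))
  halves (⊟ e)   ρ = trans (sym (⁻¹-anti-homo‿- _ _)) (⁻¹-cong (halves e ρ))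

  correct : ∀ {n} (e : Expr n) ρ → ⟦ e ⇓⟧ ρ ≈ ⟦ e ⟧ ρ
  correct e ρ = trans
    (difference-unique (trans (combination-∸ (positive e) (negative e) ρ) (comm _ _)))
    (halves e ρ)

  open Reflection setoid var ⟦_⟧ ⟦_⇓⟧ correct public using (solve; _⊜_)

  -- Derives a ≈ b from l ≈ r when a - b and l - r are the same formal combination.
  modulo : ∀ {a b l r} → l ≈ r → a ∙ r ≈ b ∙ l → a ≈ b
  modulo l≈r eq = ∙-cancelʳ _ _ _ (trans eq (∙-congˡ l≈r))

-- Zorn's lemma

IsChain : (P : Preorder a b r) → Pred (Preorder.Carrier P) p → Set _
IsChain P C = ∀ {x y} → C x → C y → x ≲ y ⊎ y ≲ x
  where open Preorder P

-- Leastness is included because `separated-limit` uses it to bound a supremum by y. For subgroups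
-- the union of a chain has it.
IsLub : (P : Preorder a b r) → Pred (Preorder.Carrier P) p → Preorder.Carrier P → Set _
IsLub P C s = (∀ {x} → C x → x ≲ s) × (∀ {y} → (∀ {x} → C x → x ≲ y) → s ≲ y)
  where open Preorder P

IsMaximal : (P : Preorder a b r) → Pred (Preorder.Carrier P) _
IsMaximal P m = ∀ {y} → m ≲ y → y ≲ m
  where open Preorder P

module _ (em : ∀ {a} → ExcludedMiddle a) where

  -- Under excluded middle every proposition lives in the lowest universe.
  Resize : Set a → Set
  Resize A = True (em {P = A})

  -- The elements reached from below by next and by suprema form a chain; its supremum is fixed.
  module FixedPoint (P : Preorder a b r)
    (lub : (C : Pred (Preorder.Carrier P) 0ℓ) → IsChain P C → ∃[ s ] IsLub P C s)
    (next : Preorder.Carrier P → Preorder.Carrier P)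
    (extensive : ∀ x → Preorder._≲_ P x (next x))
    (next-cong : ∀ {x y} → Preorder._≲_ P x y → Preorder._≲_ P y x →
      Preorder._≲_ P (next x) (next y))
    where

    open Preorder P using (Carrier; _≲_; trans)

    -- The tower starts from the supremum of the empty chain, which `limit` covers.
    data Tower : Pred Carrier (a ⊔ r ⊔ lsuc 0ℓ) where
      step  : ∀ {x} → Tower x → Tower (next x)
      limit : ∀ {C} (chain : IsChain P C) → (∀ {x} → C x → Tower x) → Tower (proj₁ (lub C chain))

    -- Stronger than comparability: x does not lie strictly between y and `next y`. This lets the
    -- induction pass from x to `next x`.
    Separated : Carrier → Carrier → Set r
    Separated x y = x ≲ y ⊎ next y ≲ x

    separated-step : ∀ {x y} → Separated x y → Separated y x → Separated (next x) y
    separated-step (inj₁ x≲y)  (inj₁ y≲x)  = inj₂ (next-cong y≲x x≲y)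
    separated-step (inj₂ ny≲x) (inj₁ y≲x)  = inj₂ (trans ny≲x (extensive _))
    separated-step _           (inj₂ nx≲y) = inj₁ nx≲y

    separated-limit : ∀ {C} (chain : IsChain P C) {y} →
      (∀ {x} → C x → Separated x y) → Separated (proj₁ (lub C chain)) y
    separated-limit {C} chain {y} sep with em {P = ∃[ x ] (C x × next y ≲ x)}
    ... | yes (x , x∈C , ny≲x) = inj₂ (trans ny≲x (proj₁ (proj₂ (lub C chain)) x∈C))
    ... | no none = inj₁ (proj₂ (proj₂ (lub C chain))
          λ x∈C → [ (λ x≲y → x≲y) , (λ ny≲x → ⊥-elim (none (_ , x∈C , ny≲x))) ]′ (sep x∈C))

    -- `separated-step` consumes the relation in both directions. The induction on x therefore hands
    -- its hypothesis, for all y, to an inner induction on y that proves the reversed relation.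
    separated : ∀ {x y} → Tower x → Tower y → Separated x y
    separated-flip : ∀ {x y} → Tower x → (∀ {y} → Tower y → Separated x y) → Tower y → Separated y x

    separated (step tx)          ty =
      separated-step (separated tx ty) (separated-flip tx (separated tx) ty)
    separated (limit chain C⊆T)  ty = separated-limit chain λ x∈C → separated (C⊆T x∈C) ty

    separated-flip tx sep (step ty) = separated-step (separated-flip tx sep ty) (sep ty)
    separated-flip tx sep (limit chain C⊆T) =
      separated-limit chain λ y∈C → separated-flip tx sep (C⊆T y∈C)

    -- `Tower` lives above the universe of the chains that `lub` accepts, hence `Resize`.
    tower-chain : IsChain P (Resize ∘ Tower)
    tower-chain tx ty with separated (toWitness tx) (toWitness ty)
    ... | inj₁ x≲y  = inj₁ x≲y
    ... | inj₂ ny≲x = inj₂ (trans (extensive _) ny≲x)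

    fixedPoint : ∃[ m ] next m ≲ m
    fixedPoint = _ , proj₁ (proj₂ (lub _ tower-chain))
      (fromWitness (step (limit tower-chain toWitness)))

  module _ (choice : ∀ {a b ℓ₁ ℓ₂} → AxiomOfChoice a b ℓ₁ ℓ₂) where

    module _ (P : Preorder a b r) where

      open Preorder P using (Carrier; _≲_; trans) renaming (refl to ≲-refl)

      zorn : ((C : Pred Carrier 0ℓ) → IsChain P C → ∃[ s ] IsLub P C s) → ∃[ m ] IsMaximal P m
      zorn lub = m , maximal
        where
        -- The second half makes y strictly larger unless x is maximal, in one formula that some y
        -- satisfies for every x.
        Improves : Carrier → Carrier → Set _
        Improves x y = x ≲ y × (y ≲ x → IsMaximal P x)

        improve : ∀ x → ∃[ y ] Improves x y
        improve x with em {P = IsMaximal P x}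
        ... | yes max = x , ≲-refl , λ _ → max
        ... | no ¬max with em {P = ∃[ y ] (x ≲ y × ¬ y ≲ x)}
        ...   | yes (y , x≲y , y≴x) = y , x≲y , λ y≲x → ⊥-elim (y≴x y≲x)
        ...   | no none = ⊥-elim (¬max λ {y} x≲y →
                  decidable-stable em λ y≴x → none (y , x≲y , y≴x))

        -- Choice yields a section that respects the equality of its domain. Mutually comparable
        -- elements are identified here, so that this respect becomes `next-cong`.
        symmetrised : Setoid _ _
        symmetrised = record
          { Carrier = Carrier
          ; _≈_ = λ x y → x ≲ y × y ≲ x
          ; isEquivalence = record
            { refl  = ≲-refl , ≲-refl
            ; sym   = λ (x≲y , y≲x) → y≲x , x≲y
            ; trans = λ (x≲y , y≲x) (y≲z , z≲y) → trans x≲y y≲z , trans z≲y y≲x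
            }
          }

        module E = Setoid symmetrised

        improvements : Setoid _ _
        improvements = record
          { Carrier = Σ[ x ∈ Carrier ] Σ[ y ∈ Carrier ] Improves x y
          ; _≈_ = λ (x , y , _) (x′ , y′ , _) → (x E.≈ x′) × (y E.≈ y′)
          ; isEquivalence = record
            { refl  = E.refl , E.refl
            ; sym   = λ (p , q) → E.sym p , E.sym q
            ; trans = λ (p , q) (p′ , q′) → E.trans p p′ , E.trans q q′
            }
          }

        section = choice {A = improvements} {B = symmetrised} record
          { to         = proj₁
          ; cong       = proj₁
          ; surjective = λ x → (x , improve x) , proj₁
          }

        choose : Func symmetrised improvements
        choose = proj₁ section

        next : Carrier → Carrier
        next x = proj₁ (proj₂ (Func.to choose x))

        extensive : ∀ x → x ≲ next x
        extensive x = trans (proj₂ (proj₂ section x)) (proj₁ (proj₂ (proj₂ (Func.to choose x))))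

        next-cong : ∀ {x y} → x ≲ y → y ≲ x → next x ≲ next y
        next-cong x≲y y≲x = proj₁ (proj₂ (Func.cong choose (x≲y , y≲x)))

        fixed = FixedPoint.fixedPoint P lub next extensive next-cong
        m = proj₁ fixed

        maximal : IsMaximal P m
        -- `choose m` starts from an x that is only equivalent to m: the fixed point makes x
        -- maximal, and the comparisons of x with m carry this over to m.
        maximal m≲y = trans (proj₂ (proj₂ (proj₂ (Func.to choose m)))
          (trans (proj₂ fixed) (proj₂ (proj₂ section m)))
          (trans (proj₁ (proj₂ section m)) m≲y)) (proj₁ (proj₂ section m))


-- Colour-permuting automorphisms

module _ (G : AbelianGroup c ℓ) (K : AbelianGroup a b) where

  private
    module G = AbelianGroup G
    module K = AbelianGroup K
  open AbelianGroupProperties K using (identityˡ-unique; inverseˡ-unique)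
  open GroupMorphisms G.rawGroup K.rawGroup

  groupHomomorphism : ∀ {f} → (∀ {x y} → x G.≈ y → f x K.≈ f y) →
    (∀ x y → f (x G.∙ y) K.≈ f x K.∙ f y) → IsGroupHomomorphism f
  groupHomomorphism {f} f-cong homo = record
    { isMonoidHomomorphism = record
      { isMagmaHomomorphism = record
        { isRelHomomorphism = record { cong = f-cong }
        ; homo = homo
        }
      ; ε-homo = f-ε
      }
    ; ⁻¹-homo = λ x → inverseˡ-unique _ _
        (K.trans (K.sym (homo _ _)) (K.trans (f-cong (G.inverseˡ x)) f-ε))
    }
    where
    f-ε : f G.ε K.≈ K.ε
    f-ε = identityˡ-unique _ _ (K.trans (K.sym (homo _ _)) (f-cong (G.identityˡ G.ε)))

module _ (G : AbelianGroup c ℓ) where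

  open AbelianGroup G renaming (_∙_ to infixl 6 _+_; ε to 0#; _⁻¹ to infix 8 -_)

  IsDouble : Pred Carrier _
  IsDouble x = ∃[ y ] x ≈ y + y

  -- Condition (5). Over the field with two elements, u and v are independent in G / 2G exactly when
  -- u, v and u - v are nonzero there.
  record QuarterPair : Set (c ⊔ ℓ) where
    field
      u v         : Carrier
      2u≈2v       : u + u ≈ v + v
      2u≉0        : ¬ u + u ≈ 0#
      4u≈0        : (u + u) + (u + u) ≈ 0#
      u-nondouble : ¬ IsDouble u
      v-nondouble : ¬ IsDouble v
      independent : ∀ x → ¬ u ≈ v + (x + x)

module ColourPermutation (em : ∀ {a} → ExcludedMiddle a)
  (G : AbelianGroup c ℓ) (S : ConnectionSet G p) (connected : Connected (Cay G S))
  (φ : Automorphism (Cay G S)) (permuting : ColourPermuting G S φ)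
  where

  open AbelianGroup G renaming
    ( _∙_ to infixl 6 _+_; ε to 0#; _⁻¹ to infix 8 -_
    ; ∙-cong to +-cong; ∙-congˡ to +-congˡ; ∙-congʳ to +-congʳ; ⁻¹-cong to -‿cong)
  open AbelianGroupProperties G using (∙-cancelˡ)
  open AbelianGroupSolver G
  open ConnectionSet S using (mem; mem-neg; mem-resp)
  open Automorphism φ using () renaming (to to f)
  open Bijection (Automorphism.bijection φ) using (surjective)
    renaming (cong to f-cong; injective to f-injective)
  module π = Bijection (proj₁ permuting)

  -- Connectedness as an induction principle: what survives the addition of a colour spreads from
  -- one vertex to all.
  walk-induction : ∀ {q} (Q : Pred Carrier q) → Q Respects _≈_ →
    (∀ {x s} → mem s → Q x → Q (x + s)) → ∀ {g h} → Q g → Q h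
  walk-induction Q resp step {g} {h} = go (connected g h)
    where
    go : ∀ {g h} → Star (_≈_ ∪ Graph.Adj (Cay G S)) g h → Q g → Q h
    go Star.ε                              q = q
    go (inj₁ g≈h ◅ walk)                   q = go walk (resp g≈h q)
    go (inj₂ (s , s∈S , h≈g+s) ◅ walk)     q = go walk (resp (sym h≈g+s) (step s∈S q))

  infix 4 _∼_
  _∼_ : Carrier → Carrier → Set ℓ
  x ∼ y = x ≈ y ⊎ x ≈ - y

  ∼-sym : ∀ {x y} → x ∼ y → y ∼ x
  ∼-sym (inj₁ x≈y)  = inj₁ (sym x≈y)
  ∼-sym (inj₂ x≈-y) = inj₂ (modulo x≈-y (solve 2 (λ x y → y ⊞ ⊟ y ⊜ ⊟ x ⊞ x) refl _ _))

  ∼-trans : ∀ {x y z} → x ∼ y → y ∼ z → x ∼ z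
  ∼-trans (inj₁ x≈y)  (inj₁ y≈z)  = inj₁ (trans x≈y y≈z)
  ∼-trans (inj₁ x≈y)  (inj₂ y≈-z) = inj₂ (trans x≈y y≈-z)
  ∼-trans (inj₂ x≈-y) (inj₁ y≈z)  = inj₂ (trans x≈-y (-‿cong y≈z))
  ∼-trans (inj₂ x≈-y) (inj₂ y≈-z) = inj₁ (modulo (+-cong x≈-y (sym y≈-z))
    (solve 3 (λ x y z → x ⊞ (⊟ y ⊞ y) ⊜ z ⊞ (x ⊞ ⊟ z)) refl _ _ _))

  ∼-mem : ∀ {x y} → x ∼ y → mem y → mem x
  ∼-mem (inj₁ x≈y)  = mem-resp (sym x≈y)
  ∼-mem (inj₂ x≈-y) = mem-resp (sym x≈-y) ∘ mem-neg

  opposite-unless-half : ∀ {x y} → x ≈ - y → x ≈ y → y + y ≈ 0#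
  opposite-unless-half x≈-y x≈y = modulo (+-cong x≈-y (sym x≈y))
    (solve 2 (λ x y → y ⊞ y ⊞ (⊟ y ⊞ x) ⊜ 𝟘 ⊞ (x ⊞ y)) refl _ _)

  half-∼ : ∀ {x y} → x ∼ y → x + x ≈ 0# → y + y ≈ 0#
  half-∼ (inj₁ x≈y)  2x≈0 = trans (+-cong (sym x≈y) (sym x≈y)) 2x≈0
  half-∼ (inj₂ x≈-y) 2x≈0 = modulo (+-cong (+-cong x≈-y x≈-y) (sym 2x≈0))
    (solve 2 (λ x y → y ⊞ y ⊞ (⊟ y ⊞ ⊟ y ⊞ (x ⊞ x)) ⊜ 𝟘 ⊞ (x ⊞ x ⊞ 𝟘)) refl _ _)

  δ : Carrier → Carrier → Carrier
  δ s g = f (g + s) + - f g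

  δ-cong : ∀ {s t g h} → s ≈ t → g ≈ h → δ s g ≈ δ t h
  δ-cong s≈t g≈h = +-cong (f-cong (+-cong g≈h s≈t)) (-‿cong (f-cong g≈h))

  δ-colour : ∀ {s} (s∈S : mem s) g → δ s g ∼ proj₁ (π.to (s , s∈S))
  δ-colour s∈S g with proj₂ permuting g _ s∈S
  ... | inj₁ eq = inj₁ (modulo eq (solve 3 (λ x y p → x ⊞ ⊟ y ⊞ (y ⊞ p) ⊜ p ⊞ x) refl _ _ _))
  ... | inj₂ eq = inj₂ (modulo eq
          (solve 3 (λ x y p → x ⊞ ⊟ y ⊞ (y ⊞ ⊟ p) ⊜ ⊟ p ⊞ x) refl _ _ _))

  δ-sign : ∀ {s} → mem s → ∀ g h → δ s g ∼ δ s h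
  δ-sign s∈S g h = ∼-trans (δ-colour s∈S g) (∼-sym (δ-colour s∈S h))

  δ-mem : ∀ {s} → mem s → ∀ g → mem (δ s g)
  δ-mem s∈S g = ∼-mem (δ-colour s∈S g) (proj₂ (π.to (_ , s∈S)))

  -- A change of sign would give φ(g + 2s) = φ(g), against injectivity.
  straight : ∀ {s} → mem s → ¬ s + s ≈ 0# → ∀ g → δ s (g + s) ≈ δ s g
  straight {s} s∈S 2s≉0 g with δ-sign s∈S (g + s) g
  ... | inj₁ same = same
  ... | inj₂ back = contradiction
    (modulo (f-injective (modulo back
        (solve 3 (λ x y z → x ⊞ ⊟ (y ⊞ ⊟ z) ⊜ z ⊞ (x ⊞ ⊟ y)) refl _ _ _)))
      (solve 2 (λ s g → s ⊞ s ⊞ g ⊜ 𝟘 ⊞ (g ⊞ s ⊞ s)) refl _ _))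
    2s≉0

  bounce : ∀ {s} → s + s ≈ 0# → ∀ g → δ s (g + s) ≈ - δ s g
  bounce {s} 2s≈0 g = modulo
    (f-cong (modulo {a = g + s + s} 2s≈0 (solve 2 (λ s g → g ⊞ s ⊞ s ⊞ 𝟘 ⊜ g ⊞ (s ⊞ s)) refl _ _)))
    (solve 3 (λ x y z → x ⊞ ⊟ y ⊞ z ⊜ ⊟ (y ⊞ ⊟ z) ⊞ x) refl _ _ _)

  -- The two routes from g to g + s + t have the same total increment.
  square : ∀ s t g → δ s (g + t) + δ t g ≈ δ t (g + s) + δ s g
  square s t g = modulo
    (f-cong {g + t + s} {g + s + t} (solve 3 (λ g s t → g ⊞ t ⊞ s ⊜ g ⊞ s ⊞ t) refl _ _ _))
    (solve 5 (λ g s t u v →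
      (u ⊞ ⊟ t ⊞ (t ⊞ ⊟ g)) ⊞ v ⊜ (v ⊞ ⊟ s ⊞ (s ⊞ ⊟ g)) ⊞ u) refl _ _ _ _ _)

  -- The colour t = π⁻¹(- π s) also consists of an involution, and walking s, t in either order
  -- moves f in opposite directions.
  involution-quarter : ∀ {s} → mem s → s + s ≈ 0# → ∀ g →
    (δ s g + δ s g) + (δ s g + δ s g) ≈ 0#
  involution-quarter {s} s∈S 2s≈0 g with em {P = δ s g + δ s g ≈ 0#}
  ... | yes 2δ≈0 = modulo (+-cong 2δ≈0 2δ≈0)
    (solve 1 (λ d → d ⊞ d ⊞ (d ⊞ d) ⊞ (𝟘 ⊞ 𝟘) ⊜ 𝟘 ⊞ (d ⊞ d ⊞ (d ⊞ d))) refl _)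
  -- With a = δ s g, the relations `opposite` and `bounce` turn the square on s and t into - a - a =
  -- a + a.
  ... | no 2δ≉0 = modulo
    (+-cong (sym (square s t g)) (+-cong (opposite (g + t)) (+-cong (sym (bounce 2t≈0 g))
      (+-cong (opposite g) (+-cong (opposite g) (+-cong (sym (opposite (g + s))) (bounce 2s≈0 g)))))))
    (solve 6 (λ A B C D E F →
      (A ⊞ A ⊞ (A ⊞ A)) ⊞ (E ⊞ B ⊞ (⊟ E ⊞ (F ⊞ (⊟ A ⊞ (⊟ A ⊞ (D ⊞ ⊟ A)))))) ⊜
      𝟘 ⊞ (D ⊞ A ⊞ (F ⊞ (⊟ B ⊞ (B ⊞ (B ⊞ (⊟ C ⊞ C)))))))
      refl (δ s g) (δ t g) (δ s (g + s)) (δ t (g + s)) (δ s (g + t)) (δ t (g + t)))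
    where
    P = proj₁ (π.to (s , s∈S))
    P∈S = proj₂ (π.to (s , s∈S))
    preimage = π.strictlySurjective (- P , mem-neg P∈S)
    t = proj₁ (proj₁ preimage)
    t∈S = proj₂ (proj₁ preimage)

    t≉s : ¬ t ≈ s
    t≉s t≈s = 2δ≉0 (half-∼ (∼-sym (δ-colour s∈S g))
      (opposite-unless-half (proj₂ preimage) (π.cong {y = s , s∈S} t≈s)))

    δt∼δs : ∀ h → δ t h ∼ δ s h
    δt∼δs h = ∼-trans (δ-colour t∈S h) (∼-trans (inj₂ (proj₂ preimage)) (∼-sym (δ-colour s∈S h)))

    opposite : ∀ h → δ t h ≈ - δ s h
    opposite h with δt∼δs h
    ... | inj₂ eq = eq
    ... | inj₁ eq = contradiction (∙-cancelˡ h t s (f-injective (modulo eq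
            (solve 3 (λ x y z → x ⊞ (y ⊞ ⊟ z) ⊜ y ⊞ (x ⊞ ⊟ z)) refl _ _ _)))) t≉s

    -- Otherwise δ t is the same at g - t and g, so φ(g - t) = φ(g) - δ t g = φ(g) + δ s g = φ(g +
    -- s). Then - t = s, which is an involution.
    2t≈0 : t + t ≈ 0#
    2t≈0 = decidable-stable em λ 2t≉0 → 2t≉0 (modulo
      (+-cong (+-cong (sym (g-t≈g+s 2t≉0)) (sym (g-t≈g+s 2t≉0))) (sym 2s≈0))
      (solve 3 (λ g s t → t ⊞ t ⊞ (g ⊞ ⊟ t ⊞ (g ⊞ ⊟ t) ⊞ (s ⊞ s)) ⊜ 𝟘 ⊞ (g ⊞ s ⊞ (g ⊞ s) ⊞ 𝟘))
        refl _ _ _))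
      where
      g-t+t≈g : g + - t + t ≈ g
      g-t+t≈g = solve 2 (λ g t → g ⊞ ⊟ t ⊞ t ⊜ g) refl g t

      g-t≈g+s : ¬ t + t ≈ 0# → g + - t ≈ g + s
      g-t≈g+s 2t≉0 = f-injective (modulo
        (+-cong (trans (sym (δ-cong refl g-t+t≈g)) (straight t∈S 2t≉0 (g + - t)))
          (+-cong (sym (opposite g)) (f-cong g-t+t≈g)))
        (solve 5 (λ X Y Z W B →
          X ⊞ (W ⊞ ⊟ X ⊞ (B ⊞ Z)) ⊜ Y ⊞ (B ⊞ (⊟ (Y ⊞ ⊟ Z) ⊞ W))) refl _ _ _ _ (δ t g)))

  -- With P = δ r g and Q = δ h g, the square shows that δ h changes along r as well, and then reads
  -- - P + Q = - Q + P.
  turn : ∀ {r h} → mem r → mem h → ∀ g → ¬ δ r (g + h) ≈ δ r g →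
    δ r g + δ r g ≈ δ h g + δ h g
  turn {r} {h} r∈S h∈S g turns
    with δ-sign r∈S (g + h) g | δ-sign h∈S (g + r) g
  ... | inj₁ same | _         = contradiction same turns
  ... | inj₂ _    | inj₁ same = contradiction (modulo (+-cong (square r h g) same)
          (solve 4 (λ A B P Q → A ⊞ (B ⊞ P ⊞ Q) ⊜ P ⊞ (A ⊞ Q ⊞ B)) refl _ _ _ _)) turns
  ... | inj₂ eqA  | inj₂ eqB  = modulo (+-cong (sym (square r h g)) (+-cong eqA (sym eqB)))
          (solve 4 (λ A B P Q → P ⊞ P ⊞ (A ⊞ Q ⊞ (⊟ P ⊞ B)) ⊜ Q ⊞ Q ⊞ (B ⊞ P ⊞ (A ⊞ ⊟ Q)))
            refl _ _ _ _)

  turn-sym : ∀ r h g → ¬ δ r (g + h) ≈ δ r g → ¬ δ h (g + r) ≈ δ h g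
  turn-sym r h g turns same = turns (modulo (+-cong (square r h g) same)
    (solve 4 (λ A B P Q → A ⊞ (B ⊞ P ⊞ Q) ⊜ P ⊞ (A ⊞ Q ⊞ B)) refl _ _ _ _))

  -- If r is not an involution, δ r has the same value P at g - r and g, and it turns at both.
  -- `turn` gives 2P = 2Q at g and 2P = 2Q′ at g - r, while Q = - Q′ because δ h changes along r.
  -- Hence 2P = - 2P.
  turn-quarter : ∀ {r h} → mem r → mem h → ∀ g → ¬ δ r (g + h) ≈ δ r g →
    (δ r g + δ r g) + (δ r g + δ r g) ≈ 0#
  turn-quarter {r} {h} r∈S h∈S g turns with em {P = r + r ≈ 0#}
  ... | yes 2r≈0 = involution-quarter r∈S 2r≈0 g
  ... | no 2r≉0 = modulo (+-cong (turn r∈S h∈S g turns) (+-cong back (+-cong P≈P′ P≈P′)))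
    (solve 3 (λ P Q P′ → P ⊞ P ⊞ (P ⊞ P) ⊞ (Q ⊞ Q ⊞ (⊟ (Q ⊞ Q) ⊞ (P′ ⊞ P′))) ⊜
                        𝟘 ⊞ (P ⊞ P ⊞ (P′ ⊞ P′ ⊞ (P ⊞ P)))) refl _ _ _)
    where
    g′ = g + - r

    g′+r≈g : g′ + r ≈ g
    g′+r≈g = solve 2 (λ g r → g ⊞ ⊟ r ⊞ r ⊜ g) refl g r

    P≈P′ : δ r g ≈ δ r g′
    P≈P′ = trans (δ-cong refl (sym g′+r≈g)) (straight r∈S 2r≉0 g′)

    turns′ : ¬ δ r (g′ + h) ≈ δ r g′
    turns′ same = turns (trans
      (δ-cong refl (solve 3 (λ g h r → g ⊞ h ⊜ g ⊞ ⊟ r ⊞ h ⊞ r) refl g h r))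
      (trans (straight r∈S 2r≉0 (g′ + h)) (trans same (sym P≈P′))))

    Q≈-Q′ : δ h (g′ + r) ≈ - δ h g′
    Q≈-Q′ with δ-sign h∈S (g′ + r) g′
    ... | inj₁ same = contradiction same (turn-sym r h g′ turns′)
    ... | inj₂ eq   = eq

    back : δ r g′ + δ r g′ ≈ - (δ h g + δ h g)
    back = modulo
      (+-cong (turn r∈S h∈S g′ turns′)
        (+-cong (+-cong Q≈-Q′ Q≈-Q′) (+-cong Q≈Q Q≈Q)))
      (solve 4 (λ P′ Q′ Q Q″ →
        P′ ⊞ P′ ⊞ (Q′ ⊞ Q′ ⊞ (⊟ Q′ ⊞ ⊟ Q′ ⊞ (Q″ ⊞ Q″))) ⊜
        ⊟ (Q ⊞ Q) ⊞ (P′ ⊞ P′ ⊞ (Q″ ⊞ Q″ ⊞ (Q ⊞ Q)))) refl _ (δ h g′) _ _)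
      where
      Q≈Q : δ h g ≈ δ h (g′ + r)
      Q≈Q = δ-cong refl (sym g′+r≈g)

  double-step : ∀ {s} → mem s → ∀ g h → δ s g + δ s g ≈ δ s h + δ s h
  double-step {s} s∈S g h = sym (walk-induction
    (λ x → δ s x + δ s x ≈ δ s g + δ s g)
    (λ x≈y eq → trans (+-cong (δ-cong refl (sym x≈y)) (δ-cong refl (sym x≈y))) eq)
    (λ t∈S eq → trans (step t∈S) eq) refl)
    where
    step : ∀ {x t} → mem t → δ s (x + t) + δ s (x + t) ≈ δ s x + δ s x
    step {x} {t} t∈S with em {P = δ s (x + t) ≈ δ s x}
    ... | yes same = +-cong same same
    ... | no turns with δ-sign s∈S (x + t) x
    ...   | inj₁ same = contradiction same turns
    ...   | inj₂ eq = modulo (+-cong (+-cong eq eq) (sym (turn-quarter s∈S t∈S x turns)))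
      (solve 2 (λ A P → A ⊞ A ⊞ (⊟ P ⊞ ⊟ P ⊞ (P ⊞ P ⊞ (P ⊞ P))) ⊜ P ⊞ P ⊞ (A ⊞ A ⊞ 𝟘)) refl _ _)

  f-double : ∀ {s} → mem s → ¬ s + s ≈ 0# → ∀ g → f (g + s + s) ≈ f g + (δ s g + δ s g)
  f-double s∈S 2s≉0 g = modulo (straight s∈S 2s≉0 g)
    (solve 3 (λ X Y Z → X ⊞ (Y ⊞ ⊟ Z) ⊜ Z ⊞ (Y ⊞ ⊟ Z ⊞ (Y ⊞ ⊟ Z)) ⊞ (X ⊞ ⊟ Y)) refl _ _ _)

  -- The increment is recorded as a double, not just as a constant: `Irregular` needs it to lie in
  -- 2G. Involutions disappear from 2x; any other colour s contributes 2 δ s, which `double-step`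
  -- makes independent of the vertex.
  f-translation : ∀ x → ∃[ c ] (∀ g → f (g + (x + x)) ≈ f g + (c + c))
  f-translation x = walk-induction
    (λ x → ∃[ c ] (∀ g → f (g + (x + x)) ≈ f g + (c + c)))
    (λ x≈y (c , eq) → c , λ g → trans (f-cong (+-congˡ (+-cong (sym x≈y) (sym x≈y)))) (eq g))
    step
    (0# , λ g → trans (f-cong (+0 g)) (sym (+0 (f g))))
    where
    +0 : ∀ y → y + (0# + 0#) ≈ y
    +0 y = solve 1 (λ y → y ⊞ (𝟘 ⊞ 𝟘) ⊜ y) refl y

    step : ∀ {x s} → mem s → ∃[ c ] (∀ g → f (g + (x + x)) ≈ f g + (c + c)) →
      ∃[ c ] (∀ g → f (g + (x + s + (x + s))) ≈ f g + (c + c))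
    step {x} {s} s∈S (c , eq) with em {P = s + s ≈ 0#}
    ... | yes 2s≈0 = c , λ g → trans (f-cong (modulo 2s≈0
      (solve 3 (λ g x s → g ⊞ (x ⊞ s ⊞ (x ⊞ s)) ⊞ 𝟘 ⊜ g ⊞ (x ⊞ x) ⊞ (s ⊞ s)) refl _ _ _))) (eq g)
    ... | no 2s≉0 = c + δ s 0# , λ g → trans
      (f-cong (solve 3 (λ g x s → g ⊞ (x ⊞ s ⊞ (x ⊞ s)) ⊜ g ⊞ (x ⊞ x) ⊞ s ⊞ s) refl _ _ _))
      (modulo (+-cong (f-double s∈S 2s≉0 (g + (x + x))) (+-cong (eq g) (double-step s∈S _ _)))
        (solve 6 (λ X Y Z c d e →
          X ⊞ (Y ⊞ (d ⊞ d) ⊞ (Z ⊞ (c ⊞ c) ⊞ (e ⊞ e))) ⊜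
          Z ⊞ (c ⊞ e ⊞ (c ⊞ e)) ⊞ (X ⊞ (Y ⊞ (d ⊞ d)))) refl _ _ _ _ (δ s (g + (x + x))) (δ s 0#)))

  δ-translation : ∀ s x g → δ s (g + (x + x)) ≈ δ s g
  δ-translation s x g with f-translation x
  ... | c , eq = modulo
    (+-cong (f-cong {g + (x + x) + s} {g + s + (x + x)}
        (solve 3 (λ g x s → g ⊞ (x ⊞ x) ⊞ s ⊜ g ⊞ s ⊞ (x ⊞ x)) refl _ _ _))
      (+-cong (eq (g + s)) (sym (eq g))))
    (solve 6 (λ X Y Z W V c →
      X ⊞ ⊟ Y ⊞ (Z ⊞ (W ⊞ (c ⊞ c) ⊞ Y)) ⊜ W ⊞ ⊟ V ⊞ (X ⊞ (Z ⊞ (V ⊞ (c ⊞ c))))) refl _ _ _ _ _ _)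

  nonzero-double : ∀ {r h} → mem r → ∀ g → ¬ δ r (g + h) ≈ δ r g → ¬ δ r g + δ r g ≈ 0#
  nonzero-double {r} {h} r∈S g turns 2δ≈0 with δ-sign r∈S (g + h) g
  ... | inj₁ same = turns same
  ... | inj₂ eq   = turns (modulo (+-cong eq (sym 2δ≈0))
          (solve 2 (λ A P → A ⊞ (⊟ P ⊞ (P ⊞ P)) ⊜ P ⊞ (A ⊞ 𝟘)) refl _ _))

  -- As neither colour is an involution, φ(g + 2r) = φ(g) + 2 δ r g and likewise for h, so
  -- injectivity pulls the relations among the increments back to r and h. If r were h modulo 2G,
  -- moving along h would affect δ r as moving along r does, that is, not at all.
  regular-pair : ∀ {r h} → mem r → mem h → ¬ r + r ≈ 0# → ¬ h + h ≈ 0# →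
    ∀ g → ¬ δ r (g + h) ≈ δ r g → QuarterPair G
  regular-pair {r} {h} r∈S h∈S 2r≉0 2h≉0 g turns = record
    { u = r
    ; v = h
    ; 2u≈2v = ∙-cancelˡ g _ _ (f-injective (modulo
        (+-cong (f-+double r∈S 2r≉0 g)
          (+-cong (turn r∈S h∈S g turns) (sym (f-+double h∈S 2h≉0 g))))
        (solve 5 (λ X Y Z P Q →
          X ⊞ (Z ⊞ (P ⊞ P) ⊞ (Q ⊞ Q ⊞ Y)) ⊜ Y ⊞ (X ⊞ (P ⊞ P ⊞ (Z ⊞ (Q ⊞ Q))))) refl _ _ _ _ _)))
    ; 2u≉0 = 2r≉0
    ; 4u≈0 = ∙-cancelˡ g _ _ (f-injective 4r-fixes)
    ; u-nondouble = λ (x , r≈2x) → turn-sym r h g turns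
        (trans (δ-cong refl (+-congˡ r≈2x)) (δ-translation h x g))
    ; v-nondouble = λ (x , h≈2x) → turns
        (trans (δ-cong refl (+-congˡ h≈2x)) (δ-translation r x g))
    ; independent = λ x r≈h+2x → turns (trans
        (δ-cong refl (modulo (sym r≈h+2x)
          (solve 4 (λ g h x r → g ⊞ h ⊞ r ⊜ g ⊞ r ⊞ (⊟ x ⊞ ⊟ x) ⊞ (h ⊞ (x ⊞ x))) refl _ _ _ _)))
        (trans (δ-translation r (- x) (g + r)) (straight r∈S 2r≉0 g)))
    }
    where
    f-+double : ∀ {s} → mem s → ¬ s + s ≈ 0# → ∀ g → f (g + (s + s)) ≈ f g + (δ s g + δ s g)
    f-+double s∈S 2s≉0 g = trans (f-cong (sym (assoc _ _ _))) (f-double s∈S 2s≉0 g)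

    4r-fixes : f (g + ((r + r) + (r + r))) ≈ f (g + 0#)
    4r-fixes = modulo
      (+-cong (f-cong (sym (assoc g (r + r) (r + r))))
        (+-cong (f-+double r∈S 2r≉0 (g + (r + r)))
        (+-cong (f-+double r∈S 2r≉0 g)
        (+-cong (double-step r∈S (g + (r + r)) g)
        (+-cong (turn-quarter r∈S h∈S g turns) (f-cong (sym (identityʳ g))))))))
      (solve 7 (λ A B C D E P Q →
        A ⊞ (B ⊞ (C ⊞ (Q ⊞ Q) ⊞ (D ⊞ (P ⊞ P) ⊞ (P ⊞ P ⊞ (𝟘 ⊞ E))))) ⊜
        E ⊞ (A ⊞ (B ⊞ (C ⊞ (Q ⊞ Q ⊞ (P ⊞ P ⊞ (P ⊞ P) ⊞ D))))))
        refl _ _ _ _ _ (δ r g) (δ r (g + (r + r))))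

  -- Here φ sends the edges of an involution s to edges of a colour q of order 4. The pair is found
  -- among q, s + q and s₁ + q, where the colour s₁ is sent to s.
  module Irregular {s} (s∈S : mem s) (2s≈0 : s + s ≈ 0#) (g : Carrier)
    (2q≉0 : ¬ δ s g + δ s g ≈ 0#) where

    q = δ s g

    4q≈0 : (q + q) + (q + q) ≈ 0#
    4q≈0 = involution-quarter s∈S 2s≈0 g

    s-flips : ¬ δ s (g + s) ≈ q
    s-flips same = 2q≉0 (opposite-unless-half (bounce 2s≈0 g) same)

    s-nondouble : ¬ IsDouble G s
    s-nondouble (x , s≈2x) = s-flips (trans (δ-cong refl (+-congˡ s≈2x)) (δ-translation s x g))

    -- Otherwise q is s modulo 2G and δ q differs from δ s by a constant. As q is not an involution,
    -- δ q is unchanged along q, hence so is δ s; but δ s takes the same value at g + q as at g + s,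
    -- where its sign has changed.
    s+q-nondouble : ¬ IsDouble G (s + q)
    s+q-nondouble (x , s+q≈2x) = s-flips (trans s-at-q (modulo
      (+-cong (δq g) (+-cong (sym (δq (g + q))) (straight (δ-mem s∈S g) 2q≉0 g)))
      (solve 5 (λ A B P Q c →
        A ⊞ (Q ⊞ c ⊞ (B ⊞ P)) ⊜ Q ⊞ (P ⊞ (A ⊞ c ⊞ B))) refl
        (δ s (g + q)) (δ q (g + q)) (δ q g) q _)))
      where
      y = x + - s
      e = proj₁ (f-translation y)

      q≈s+2y : q ≈ s + (y + y)
      q≈s+2y = modulo s+q≈2x
        (solve 3 (λ s q x → q ⊞ (x ⊞ x) ⊜ s ⊞ (x ⊞ ⊟ s ⊞ (x ⊞ ⊟ s)) ⊞ (s ⊞ q)) refl _ _ _)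

      through-s : ∀ k → k + q ≈ k + s + (y + y)
      through-s k = trans (+-congˡ q≈s+2y) (sym (assoc _ _ _))

      δq : ∀ k → δ q k ≈ δ s k + (e + e)
      δq k = modulo (trans (f-cong (through-s k)) (proj₂ (f-translation y) (k + s)))
        (solve 4 (λ A B K c → A ⊞ ⊟ K ⊞ (B ⊞ c) ⊜ B ⊞ ⊟ K ⊞ c ⊞ A) refl _ _ _ _)

      s-at-q : δ s (g + s) ≈ δ s (g + q)
      s-at-q = trans (sym (δ-translation s y (g + s))) (δ-cong refl (sym (through-s g)))

    preimage = π.strictlySurjective (s , s∈S)
    s₁ = proj₁ (proj₁ preimage)
    s₁∈S = proj₂ (proj₁ preimage)

    -- The sign is immaterial because s = - s.
    δs₁ : ∀ k → δ s₁ k ≈ s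
    δs₁ k with δ-colour s₁∈S k
    ... | inj₁ eq = trans eq (proj₂ preimage)
    ... | inj₂ eq = modulo (+-cong eq (+-cong (sym (proj₂ preimage)) (sym 2s≈0)))
            (solve 3 (λ A P s → A ⊞ (⊟ P ⊞ (P ⊞ (s ⊞ s))) ⊜ s ⊞ (A ⊞ (s ⊞ 𝟘))) refl _ _ _)

    2s₁≈0 : s₁ + s₁ ≈ 0#
    2s₁≈0 = ∙-cancelˡ g _ _ (f-injective (modulo
      (+-cong (f-cong (sym (assoc g s₁ s₁)))
        (+-cong (δs₁ (g + s₁)) (+-cong (δs₁ g) (+-cong 2s≈0 (f-cong (sym (identityʳ g)))))))
      (solve 6 (λ A B C D E s →
        A ⊞ (B ⊞ (s ⊞ (s ⊞ (𝟘 ⊞ D)))) ⊜ D ⊞ (A ⊞ (B ⊞ ⊟ C ⊞ (C ⊞ ⊟ E ⊞ (s ⊞ s ⊞ E))))) refl _ _ _ _ _ _)))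

    s₁-nondouble : ¬ IsDouble G s₁
    s₁-nondouble (x , s₁≈2x) with f-translation x
    ... | c , eq = s-nondouble (c , modulo
      (+-cong (sym (δs₁ g)) (trans (f-cong (+-congˡ s₁≈2x)) (eq g)))
      (solve 4 (λ s A K c → s ⊞ (A ⊞ ⊟ K ⊞ (K ⊞ c)) ⊜ c ⊞ (s ⊞ A)) refl _ _ _ _))

    -- If s₁ were s modulo 2G, comparing the increments of φ from g to g + s₁ and to g + s would
    -- show that s is q modulo 2G, and s + q would be double.
    s₁+s-nondouble : ¬ IsDouble G (s₁ + s)
    s₁+s-nondouble (x , s₁+s≈2x) = s+q-nondouble (q + e , modulo
      (+-cong (sym (δs₁ g)) (trans (f-cong through-s) (proj₂ (f-translation y) (g + s))))
      (solve 5 (λ s A K B c →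
        s ⊞ (B ⊞ ⊟ K) ⊞ (A ⊞ ⊟ K ⊞ (B ⊞ (c ⊞ c))) ⊜
        B ⊞ ⊟ K ⊞ c ⊞ (B ⊞ ⊟ K ⊞ c) ⊞ (s ⊞ A)) refl _ _ _ _ _))
      where
      y = x + - s
      e = proj₁ (f-translation y)

      through-s : g + s₁ ≈ g + s + (y + y)
      through-s = modulo s₁+s≈2x
        (solve 4 (λ g s s₁ x → g ⊞ s₁ ⊞ (x ⊞ x) ⊜ g ⊞ s ⊞ (x ⊞ ⊟ s ⊞ (x ⊞ ⊟ s)) ⊞ (s₁ ⊞ s))
          refl _ _ _ _)

    -- Modulo 2G the pair is q and s + q or, when q is double, s and s₁. In the second case adding q
    -- turns the involutions s and s₁ into elements of order 4 with the same double.
    pair : QuarterPair G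
    pair with em {P = IsDouble G q}
    ... | no q-nondouble = record
      { u = q
      ; v = s + q
      ; 2u≈2v = modulo (sym 2s≈0)
          (solve 2 (λ s q → q ⊞ q ⊞ (s ⊞ s) ⊜ s ⊞ q ⊞ (s ⊞ q) ⊞ 𝟘) refl _ _)
      ; 2u≉0 = 2q≉0
      ; 4u≈0 = 4q≈0
      ; u-nondouble = q-nondouble
      ; v-nondouble = s+q-nondouble
      ; independent = λ x eq → s-nondouble (- x , modulo (sym eq)
          (solve 3 (λ s q x → s ⊞ q ⊜ ⊟ x ⊞ ⊟ x ⊞ (s ⊞ q ⊞ (x ⊞ x))) refl _ _ _))
      }
    ... | yes (y , q≈2y) = record
      { u = s + q
      ; v = s₁ + q
      ; 2u≈2v = modulo (+-cong 2s≈0 (sym 2s₁≈0))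
          (solve 3 (λ s s₁ q → s ⊞ q ⊞ (s ⊞ q) ⊞ (𝟘 ⊞ (s₁ ⊞ s₁)) ⊜
                               s₁ ⊞ q ⊞ (s₁ ⊞ q) ⊞ (s ⊞ s ⊞ 𝟘)) refl _ _ _)
      ; 2u≉0 = λ eq → 2q≉0 (modulo (+-cong eq (sym 2s≈0))
          (solve 2 (λ s q → q ⊞ q ⊞ (𝟘 ⊞ (s ⊞ s)) ⊜ 𝟘 ⊞ (s ⊞ q ⊞ (s ⊞ q) ⊞ 𝟘)) refl _ _))
      ; 4u≈0 = modulo (+-cong (+-cong 2s≈0 2s≈0) 4q≈0)
          (solve 2 (λ s q → s ⊞ q ⊞ (s ⊞ q) ⊞ (s ⊞ q ⊞ (s ⊞ q)) ⊞ (𝟘 ⊞ 𝟘 ⊞ 𝟘) ⊜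
                            𝟘 ⊞ (s ⊞ s ⊞ (s ⊞ s) ⊞ (q ⊞ q ⊞ (q ⊞ q)))) refl _ _)
      ; u-nondouble = s+q-nondouble
      ; v-nondouble = λ (x , eq) → s₁-nondouble (x + - y , modulo (+-cong eq (sym q≈2y))
          (solve 4 (λ s₁ q x y → s₁ ⊞ (x ⊞ x ⊞ q) ⊜ x ⊞ ⊟ y ⊞ (x ⊞ ⊟ y) ⊞ (s₁ ⊞ q ⊞ (y ⊞ y)))
            refl _ _ _ _))
      ; independent = λ x eq → s₁+s-nondouble (s₁ + x , modulo eq
          (solve 4 (λ s₁ s q x → s₁ ⊞ s ⊞ (s₁ ⊞ q ⊞ (x ⊞ x)) ⊜ s₁ ⊞ x ⊞ (s₁ ⊞ x) ⊞ (s ⊞ q))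
            refl _ _ _ _))
      }

  turn-pair : ∀ {r h} → mem r → mem h → ∀ g → ¬ δ r (g + h) ≈ δ r g → QuarterPair G
  turn-pair {r} {h} r∈S h∈S g turns with em {P = r + r ≈ 0#} | em {P = h + h ≈ 0#}
  ... | yes 2r≈0 | _        = Irregular.pair r∈S 2r≈0 g (nonzero-double r∈S g turns)
  ... | no _     | yes 2h≈0 =
    Irregular.pair h∈S 2h≈0 g (nonzero-double h∈S g (turn-sym r h g turns))
  ... | no 2r≉0  | no 2h≉0  = regular-pair r∈S h∈S 2r≉0 2h≉0 g turns

  affine-without-turns : (∀ {r h} → mem r → mem h → ∀ g → δ r (g + h) ≈ δ r g) → Affine G f
  affine-without-turns constant = τ , f 0# , record
    { isGroupMonomorphism = record
      { isGroupHomomorphism = groupHomomorphism G G (λ x≈y → +-congʳ (f-cong x≈y)) τ-homo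
      ; injective = λ eq → f-injective (modulo eq
          (solve 3 (λ A B Z → A ⊞ (B ⊞ ⊟ Z) ⊜ B ⊞ (A ⊞ ⊟ Z)) refl _ _ _))
      }
    ; surjective = λ y → proj₁ (surjective (y + f 0#)) , λ z≈x →
        modulo (proj₂ (surjective (y + f 0#)) z≈x)
          (solve 3 (λ A Z y → A ⊞ ⊟ Z ⊞ (y ⊞ Z) ⊜ y ⊞ A) refl _ _ _)
    } , λ x → solve 2 (λ A Z → A ⊜ A ⊞ ⊟ Z ⊞ Z) refl _ _
    where
    τ : Carrier → Carrier
    τ x = f x + - f 0#

    constant-everywhere : ∀ {r} → mem r → ∀ g h → δ r g ≈ δ r h
    constant-everywhere {r} r∈S g h = sym (walk-induction (λ x → δ r x ≈ δ r g)
      (λ x≈y eq → trans (δ-cong refl (sym x≈y)) eq)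
      (λ h∈S eq → trans (constant r∈S h∈S _) eq) refl)

    translation : ∀ x g → f (g + x) + - f g ≈ τ x
    translation x = walk-induction (λ x → ∀ g → f (g + x) + - f g ≈ τ x)
      (λ x≈y eq g → trans (+-congʳ (f-cong (+-congˡ (sym x≈y))))
        (trans (eq g) (+-congʳ (f-cong x≈y))))
      (λ {x} {s} s∈S eq g → modulo
        (+-cong (f-cong (sym (assoc g x s))) (+-cong (constant-everywhere s∈S (g + x) x) (eq g)))
        (solve 7 (λ A B C D E F Z →
          A ⊞ ⊟ D ⊞ (B ⊞ (E ⊞ ⊟ C ⊞ (C ⊞ ⊟ Z))) ⊜ E ⊞ ⊟ Z ⊞ (A ⊞ (B ⊞ ⊟ F ⊞ (F ⊞ ⊟ D))))
          refl _ _ _ _ _ _ _))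
      (λ g → trans (+-congʳ (f-cong (identityʳ g))) (trans (inverseʳ _) (sym (inverseʳ _))))

    τ-homo : ∀ x y → τ (x + y) ≈ τ x + τ y
    τ-homo x y = modulo (translation y x)
      (solve 4 (λ A B C Z → A ⊞ ⊟ Z ⊞ (C ⊞ ⊟ Z) ⊜ B ⊞ ⊟ Z ⊞ (C ⊞ ⊟ Z) ⊞ (A ⊞ ⊟ B)) refl _ _ _ _)

  affine-without-pair : ¬ QuarterPair G → Affine G f
  affine-without-pair none = affine-without-turns λ r∈S h∈S g →
    decidable-stable em λ turns → none (turn-pair r∈S h∈S g turns)

-- A Cayley graph that is not CCA

-- A homomorphism to ℤ/2. Boolean values let the product of two of them be written with `_∧_` and
-- steer a conditional.
record Parity (G : AbelianGroup c ℓ) : Set (c ⊔ ℓ) where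
  open AbelianGroup G
  field
    parity : Carrier → Bool
    cong   : ∀ {x y} → x ≈ y → parity x ≡ parity y
    homo   : ∀ x y → parity (x ∙ y) ≡ parity x xor parity y

  ε-even : parity ε ≡ false
  ε-even = ≡.trans (cong (sym (identityˡ ε))) (≡.trans (homo ε ε) (xor-same (parity ε)))

  double-even : ∀ x → parity (x ∙ x) ≡ false
  double-even x = ≡.trans (homo x x) (xor-same (parity x))

  even-shift : ∀ x {y} → parity y ≡ false → parity (x ∙ y) ≡ parity x
  even-shift x eq = ≡.trans (homo x _) (≡.trans (≡.cong (parity x xor_) eq) (xor-identityʳ _))

  neg-parity : ∀ x → parity (x ⁻¹) ≡ parity x
  neg-parity x = ≡.trans (≡.sym (even-shift (x ⁻¹) (double-even x)))
    (cong (trans (sym (assoc _ _ _)) (trans (∙-congʳ (inverseˡ x)) (identityˡ x))))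

record DualPair (G : AbelianGroup c ℓ) : Set (c ⊔ ℓ) where
  open AbelianGroup G
  field
    α β   : Parity G
    u v   : Carrier
    αu≡1  : Parity.parity α u ≡ true
    βu≡0  : Parity.parity β u ≡ false
    αv≡0  : Parity.parity α v ≡ false
    βv≡1  : Parity.parity β v ≡ true
    2u≈2v : u ∙ u ≈ v ∙ v
    2u≉0  : ¬ u ∙ u ≈ ε
    4u≈0  : (u ∙ u) ∙ (u ∙ u) ≈ ε

-- With z = 2u = 2v, the map g ↦ g + α(g)β(g)z preserves the colour of s whenever α(s) = β(s) = 0,
-- since it commutes with s, and whenever 2s = z, since then s + z = - s. It is not affine because
-- αβ is not additive.
module Twist (G : AbelianGroup c ℓ) (D : DualPair G) where

  open AbelianGroup G renaming
    ( _∙_ to infixl 6 _+_; ε to 0#; _⁻¹ to infix 8 -_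
    ; ∙-cong to +-cong; ∙-congˡ to +-congˡ; ∙-congʳ to +-congʳ; ⁻¹-cong to -‿cong)
  open AbelianGroupSolver G
  open DualPair D
  open Parity using (parity)
  module α = Parity α
  module β = Parity β

  z = u + u

  -- Membership lists the two cases in which the twist preserves a colour. It holds for u, for v and
  -- on the common kernel of α and β, which together generate G.
  S : ConnectionSet G (c ⊔ ℓ)
  S = record
    { mem = λ s → Lift c ((α.parity s ≡ false × β.parity s ≡ false) ⊎ s + s ≈ z)
    ; mem-resp = λ where
        s≈t (lift (inj₁ (αs , βs))) → lift (inj₁
          (≡.trans (α.cong (sym s≈t)) αs , ≡.trans (β.cong (sym s≈t)) βs))
        s≈t (lift (inj₂ 2s≈z)) → lift (inj₂ (trans (+-cong (sym s≈t) (sym s≈t)) 2s≈z))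
    ; mem-neg = λ where
        (lift (inj₁ (αs , βs))) → lift (inj₁
          (≡.trans (α.neg-parity _) αs , ≡.trans (β.neg-parity _) βs))
        (lift (inj₂ 2s≈z)) → lift (inj₂ (modulo (+-cong (sym 2s≈z) (sym 4u≈0))
          (solve 2 (λ s u → ⊟ s ⊞ ⊟ s ⊞ (s ⊞ s ⊞ (u ⊞ u ⊞ (u ⊞ u))) ⊜ u ⊞ u ⊞ (u ⊞ u ⊞ 𝟘))
            refl _ _)))
    }

  open ConnectionSet S using (mem; mem-neg)

  if-even : ∀ (π : Parity G) b {x} → Parity.parity π x ≡ false →
    Parity.parity π (if b then x else 0#) ≡ false
  if-even π true  even = even
  if-even π false _    = Parity.ε-even π

  mem-if : ∀ b {x} → x + x ≈ z → mem (if b then x else 0#)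
  mem-if true  eq = lift (inj₂ eq)
  mem-if false eq = lift (inj₁ (α.ε-even , β.ε-even))

  -- As u and v are dual to α and β, removing from k those that its parities call for leaves an
  -- element of both kernels. So three edges, possibly loops of colour 0, lead from any vertex to
  -- any other.
  coset : ∀ k → mem (k + - ((if α.parity k then u else 0#) + (if β.parity k then v else 0#)))
  coset k = lift (inj₁
    ( vanish α (≡.trans (α.homo _ _) (≡.cong₂ _xor_
        (select-1 α (α.parity k) αu≡1) (if-even α (β.parity k) αv≡0))) (xor-identityʳ _)
    , vanish β (≡.trans (β.homo _ _) (≡.cong₂ _xor_
        (if-even β (α.parity k) βu≡0) (select-1 β (β.parity k) βv≡1))) ≡.refl))
    where
    select-1 : ∀ (π : Parity G) b {x} → parity π x ≡ true →
      parity π (if b then x else 0#) ≡ b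
    select-1 π true  eq = eq
    select-1 π false _  = Parity.ε-even π

    vanish : ∀ (π : Parity G) {x b} → parity π x ≡ b → b ≡ parity π k → parity π (k + - x) ≡ false
    vanish π {x} eq eq′ = ≡.trans (Parity.homo π k (- x)) (≡.trans
      (≡.cong (parity π k xor_) (≡.trans (Parity.neg-parity π x) (≡.trans eq eq′)))
      (xor-same (parity π k)))

  connected : Connected (Cay G S)
  connected g h =
    edge (mem-if (α.parity k) refl) ◅ edge (mem-if (β.parity k) (sym 2u≈2v)) ◅ edge (coset k) ◅
    inj₁ (solve 4 (λ g h a b → g ⊞ a ⊞ b ⊞ (h ⊞ ⊟ g ⊞ ⊟ (a ⊞ b)) ⊜ h) refl _ _ _ _) ◅ Star.ε
    where
    k = h + - g

    edge : ∀ {g s} → mem s → (_≈_ ∪ Graph.Adj (Cay G S)) g (g + s)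
    edge s∈S = inj₂ (_ , s∈S , refl)

  bend : Bool → Carrier
  bend b = if b then z else 0#

  αβ : Carrier → Bool
  αβ g = α.parity g ∧ β.parity g

  twist : Carrier → Carrier
  twist g = g + bend (αβ g)

  αβ-cong : ∀ {g h} → g ≈ h → αβ g ≡ αβ h
  αβ-cong g≈h = ≡.cong₂ _∧_ (α.cong g≈h) (β.cong g≈h)

  αβ-even-shift : ∀ g {s} → α.parity s ≡ false → β.parity s ≡ false → αβ (g + s) ≡ αβ g
  αβ-even-shift g αs βs = ≡.cong₂ _∧_ (α.even-shift g αs) (β.even-shift g βs)

  twist-cong : ∀ {g h} → g ≈ h → twist g ≈ twist h
  twist-cong g≈h = +-cong g≈h (reflexive (≡.cong bend (αβ-cong g≈h)))

  twist-involutive : ∀ g → twist (twist g) ≈ g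
  twist-involutive g = trans
    (+-congˡ (reflexive (≡.cong bend (αβ-even-shift g
      (if-even α (αβ g) (α.double-even u)) (if-even β (αβ g) (β.double-even u))))))
    (cancel (αβ g))
    where
    cancel : ∀ b → g + bend b + bend b ≈ g
    cancel true  = modulo 4u≈0
      (solve 2 (λ g u → g ⊞ (u ⊞ u) ⊞ (u ⊞ u) ⊞ 𝟘 ⊜ g ⊞ (u ⊞ u ⊞ (u ⊞ u))) refl _ _)
    cancel false = solve 1 (λ g → g ⊞ 𝟘 ⊞ 𝟘 ⊜ g) refl g

  twist-colour : ∀ g s → mem s → twist (g + s) ≈ twist g + s ⊎ twist (g + s) ≈ twist g + - s
  twist-colour g s (lift (inj₁ (αs , βs))) = inj₁ (trans
    (+-congˡ (reflexive (≡.cong bend (αβ-even-shift g αs βs))))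
    (solve 3 (λ g s b → g ⊞ s ⊞ b ⊜ g ⊞ b ⊞ s) refl _ _ _))
  twist-colour g s (lift (inj₂ 2s≈z)) = choose (αβ (g + s)) (αβ g)
    where
    choose : ∀ b b′ → g + s + bend b ≈ g + bend b′ + s ⊎ g + s + bend b ≈ g + bend b′ + - s
    choose true  true  = inj₁ (solve 3 (λ g s b → g ⊞ s ⊞ b ⊜ g ⊞ b ⊞ s) refl g s z)
    choose true  false = inj₂ (modulo (+-cong 2s≈z 4u≈0)
      (solve 3 (λ g s u → g ⊞ s ⊞ (u ⊞ u) ⊞ (u ⊞ u ⊞ 𝟘) ⊜
                          g ⊞ 𝟘 ⊞ ⊟ s ⊞ (s ⊞ s ⊞ (u ⊞ u ⊞ (u ⊞ u)))) refl g s u))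
    choose false true  = inj₂ (modulo 2s≈z
      (solve 3 (λ g s u → g ⊞ s ⊞ 𝟘 ⊞ (u ⊞ u) ⊜ g ⊞ (u ⊞ u) ⊞ ⊟ s ⊞ (s ⊞ s)) refl g s u))
    choose false false = inj₁ (solve 2 (λ g s → g ⊞ s ⊞ 𝟘 ⊜ g ⊞ 𝟘 ⊞ s) refl g s)

  twist-adj : ∀ {g h} → Graph.Adj (Cay G S) g h → Graph.Adj (Cay G S) (twist g) (twist h)
  twist-adj {g} (s , s∈S , h≈g+s) with twist-colour g s s∈S
  ... | inj₁ eq = s , s∈S , trans (twist-cong h≈g+s) eq
  ... | inj₂ eq = - s , mem-neg s∈S , trans (twist-cong h≈g+s) eq

  automorphism : Automorphism (Cay G S)
  automorphism = record
    { bijection = record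
      { to = twist
      ; cong = twist-cong
      ; bijective =
          (λ {g} {h} eq → trans (sym (twist-involutive g))
            (trans (twist-cong eq) (twist-involutive h))) ,
          λ g → twist g , λ eq → trans (twist-cong eq) (twist-involutive g)
      }
    ; adj-iff = λ g h → mk⇔ twist-adj λ adj →
        proj₁ resp (twist-involutive h) (proj₂ resp (twist-involutive g) (twist-adj adj))
    }
    where resp = Graph.Adj-resp (Cay G S)

  -- An affine map f satisfies f(u + v) + f(0) = f(u) + f(v). The twist fixes 0, u and v but moves u
  -- + v by z.
  not-affine : ¬ Affine G twist
  not-affine (τ , t , τ-iso , twist≈τ+t) = 2u≉0 (modulo
    (+-cong (affine-at bent) (+-cong (τ-iso.∙-homo u v) (+-cong (sym (affine-at fixed-u))
      (+-cong (sym (affine-at fixed-v)) (+-cong (affine-at fixed-0) τ-iso.ε-homo)))))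
    (solve 7 (λ u v τuv τu τv τ0 t →
      u ⊞ u ⊞ (τuv ⊞ t ⊞ (τu ⊞ τv ⊞ (u ⊞ (v ⊞ (τ0 ⊞ t ⊞ 𝟘))))) ⊜
      𝟘 ⊞ (u ⊞ v ⊞ (u ⊞ u) ⊞ (τuv ⊞ (τu ⊞ t ⊞ (τv ⊞ t ⊞ (𝟘 ⊞ τ0))))))
      refl _ _ _ _ _ _ _))
    where
    module τ-iso = GroupMorphisms.IsGroupIsomorphism τ-iso

    affine-at : ∀ {x y} → twist x ≈ y → y ≈ τ x + t
    affine-at eq = trans (sym eq) (twist≈τ+t _)

    twist-at : ∀ {x a b} → α.parity x ≡ a → β.parity x ≡ b → twist x ≈ x + bend (a ∧ b)
    twist-at αx βx = +-congˡ (reflexive (≡.cong₂ (λ a b → bend (a ∧ b)) αx βx))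

    fixed-u : twist u ≈ u
    fixed-u = trans (twist-at αu≡1 βu≡0) (identityʳ u)

    fixed-v : twist v ≈ v
    fixed-v = trans (twist-at αv≡0 ≡.refl) (identityʳ v)

    fixed-0 : twist 0# ≈ 0#
    fixed-0 = trans (twist-at α.ε-even ≡.refl) (identityʳ 0#)

    bent : twist (u + v) ≈ u + v + z
    bent = twist-at
      (≡.trans (α.homo u v) (≡.cong₂ _xor_ αu≡1 αv≡0))
      (≡.trans (β.homo u v) (≡.cong₂ _xor_ βu≡0 βv≡1))

  notCCA : ¬ IsCCA G S
  notCCA cca = not-affine (cca automorphism twist-colour)

-- Dual pairs in the two kinds of direct sum

odd : ℕ → Bool
odd zero    = false
odd (suc n) = not (odd n)

DualPair-pull : {G : AbelianGroup c ℓ} {K : AbelianGroup a b} → G ≅ K → DualPair K → DualPair G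
DualPair-pull {G = G} {K = K} (f , iso) D = record
  { α = pull α ; β = pull β
  ; u = lift-elt u ; v = lift-elt v
  ; αu≡1 = at α αu≡1 ; βu≡0 = at β βu≡0 ; αv≡0 = at α αv≡0 ; βv≡1 = at β βv≡1
  ; 2u≈2v = iso.injective (K.trans (f-double u) (K.trans 2u≈2v (K.sym (f-double v))))
  ; 2u≉0 = λ eq → 2u≉0 (K.trans (K.sym (f-double u)) (K.trans (iso.⟦⟧-cong eq) iso.ε-homo))
  ; 4u≈0 = iso.injective (K.trans (iso.∙-homo _ _)
      (K.trans (K.∙-cong (f-double u) (f-double u)) (K.trans 4u≈0 (K.sym iso.ε-homo))))
  }
  where
  module G = AbelianGroup G
  module K = AbelianGroup K
  module iso = GroupMorphisms.IsGroupIsomorphism iso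
  open DualPair D

  pull : Parity K → Parity G
  pull π = record
    { parity = π.parity ∘ f
    ; cong   = π.cong ∘ iso.⟦⟧-cong
    ; homo   = λ x y → ≡.trans (π.cong (iso.∙-homo x y)) (π.homo (f x) (f y))
    }
    where module π = Parity π

  lift-elt : K.Carrier → G.Carrier
  lift-elt x = proj₁ (iso.surjective x)

  f-lift : ∀ x → f (lift-elt x) K.≈ x
  f-lift x = proj₂ (iso.surjective x) G.refl

  at : ∀ (π : Parity K) {x b} → Parity.parity π x ≡ b → Parity.parity π (f (lift-elt x)) ≡ b
  at π eq = ≡.trans (Parity.cong π (f-lift _)) eq

  f-double : ∀ x → f (lift-elt x G.∙ lift-elt x) K.≈ x K.∙ x
  f-double x = K.trans (iso.∙-homo _ _) (K.∙-cong (f-lift x) (f-lift x))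

parity-of : ∀ n .{{_ : ℕ.NonZero n}} →
  (∀ i j → odd (toℕ (AbelianGroup._∙_ (ℤ/ n) i j)) ≡ odd (toℕ i) xor odd (toℕ j)) → Parity (ℤ/ n)
parity-of n homo = record { parity = odd ∘ toℕ ; cong = ≡.cong _ ; homo = homo }

parity₂ : Parity (ℤ/ 2)
parity₂ = parity-of 2 (toWitness {a? = Fin.all? λ _ → Fin.all? λ _ → _ Bool.≟ _} _)

parity₄ : Parity (ℤ/ 4)
parity₄ = parity-of 4 (toWitness {a? = Fin.all? λ _ → Fin.all? λ _ → _ Bool.≟ _} _)

module _ (H : AbelianGroup c ℓ) where

  open AbelianGroup H

  DualPair-4⊕2 : DualPair (H ⊕ ℤ/ 4 ⊕ ℤ/ 2)
  DualPair-4⊕2 = record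
    -- Adding the parity of j makes α vanish at v = (0, 1, 1), whose middle coordinate is that of u.
    { α = record
      { parity = λ (_ , i , j) → π₄.parity i xor π₂.parity j
      ; cong = λ (_ , eq₄ , eq₂) → ≡.cong₂ _xor_ (π₄.cong eq₄) (π₂.cong eq₂)
      ; homo = λ (_ , i , j) (_ , i′ , j′) → ≡.trans
          (≡.cong₂ _xor_ (π₄.homo i i′) (π₂.homo j j′))
          (xor.interchange (π₄.parity i) (π₄.parity i′) (π₂.parity j) (π₂.parity j′))
      }
    ; β = record
      { parity = λ (_ , i , j) → π₂.parity j
      ; cong = λ (_ , _ , eq) → π₂.cong eq
      ; homo = λ (_ , _ , j) (_ , _ , j′) → π₂.homo j j′
      }
    ; u = ε , suc zero , zero
    ; v = ε , suc zero , suc zero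
    ; αu≡1 = ≡.refl ; βu≡0 = ≡.refl ; αv≡0 = ≡.refl ; βv≡1 = ≡.refl
    ; 2u≈2v = refl , ≡.refl , ≡.refl
    ; 2u≉0 = λ ()
    ; 4u≈0 = trans (∙-cong (identityˡ ε) (identityˡ ε)) (identityˡ ε) , ≡.refl , ≡.refl
    }
    where
    module π₂ = Parity parity₂
    module π₄ = Parity parity₄
    module xor = CommutativeSemigroupProperties
      (CommutativeMonoid.commutativeSemigroup
        (CommutativeRing.+-commutativeMonoid Bool.xor-∧-commutativeRing))

  -- The two copies of ℤ/2 supply the duality; the same h in u and v makes their common double (2h,
  -- 0, 0) nonzero.
  DualPair-2⊕2 : HasElementOfOrder H 4 → DualPair (H ⊕ ℤ/ 2 ⊕ ℤ/ 2)
  DualPair-2⊕2 (h , _ , 4h≈0 , minimal) = record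
    { α = record
      { parity = λ (_ , i , _) → π₂.parity i
      ; cong = λ (_ , eq , _) → π₂.cong eq
      ; homo = λ (_ , i , _) (_ , i′ , _) → π₂.homo i i′
      }
    ; β = record
      { parity = λ (_ , _ , j) → π₂.parity j
      ; cong = λ (_ , _ , eq) → π₂.cong eq
      ; homo = λ (_ , _ , j) (_ , _ , j′) → π₂.homo j j′
      }
    ; u = h , suc zero , zero
    ; v = h , zero , suc zero
    ; αu≡1 = ≡.refl ; βu≡0 = ≡.refl ; αv≡0 = ≡.refl ; βv≡1 = ≡.refl
    ; 2u≈2v = refl , ≡.refl , ≡.refl
    ; 2u≉0 = λ (2h≈0 , _) → minimal 2 (s≤s z≤n) (s≤s (s≤s (s≤s z≤n)))
        (trans (solve 1 (λ h → h ⊞ (h ⊞ 𝟘) ⊜ h ⊞ h) refl h) 2h≈0)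
    ; 4u≈0 = trans (solve 1 (λ h → h ⊞ h ⊞ (h ⊞ h) ⊜ h ⊞ (h ⊞ (h ⊞ (h ⊞ 𝟘)))) refl h) 4h≈0
        , ≡.refl , ≡.refl
    }
    where
    open AbelianGroupSolver H
    module π₂ = Parity parity₂

  order-4-from-8 : HasElementOfOrder H 8 → HasElementOfOrder H 4
  order-4-from-8 (x , _ , 8x≈0 , minimal) = 2 · x , s≤s z≤n , trans (×-assocˡ x 4 2) 8x≈0 ,
    λ m 0<m m<4 eq → minimal (m ℕ.* 2) (ℕ.*-monoˡ-< 2 0<m) (ℕ.*-monoˡ-< 2 m<4)
      (trans (sym (×-assocˡ x m 2)) eq)
    where open Mult commutativeMonoid using (×-assocˡ) renaming (_×_ to infixr 8 _·_)

-- Characters and direct summands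

mod-toℕ : ∀ {n} .{{_ : ℕ.NonZero n}} (i : Fin n) → toℕ i mod n ≡ i
mod-toℕ {n} i = Fin.toℕ-injective
  (≡.trans (Fin.toℕ-fromℕ< (m%n<n (toℕ i) n)) (m<n⇒m%n≡m (Fin.toℕ<n i)))

module _ (G : AbelianGroup c ℓ) where

  open AbelianGroup G renaming
    ( _∙_ to infixl 6 _+_; ε to 0#; _⁻¹ to infix 8 -_
    ; ∙-cong to +-cong; ∙-congˡ to +-congˡ; ∙-congʳ to +-congʳ; ⁻¹-cong to -‿cong)
  open AbelianGroupSolver G
  open Mult commutativeMonoid
    using (×-homo-+; ×-congˡ; ×-congʳ; ×-assocˡ; ×-distrib-+) renaming (_×_ to infixr 8 _·_)

  ·-zero : ∀ n → n · 0# ≈ 0#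
  ·-zero zero    = refl
  ·-zero (suc n) = trans (identityˡ _) (·-zero n)

  ·-neg : ∀ n x → n · (- x) ≈ - (n · x)
  ·-neg n x = modulo
    (trans (sym (×-distrib-+ (- x) x n)) (trans (×-congʳ n (inverseˡ x)) (·-zero n)))
    (solve 2 (λ a b → a ⊞ 𝟘 ⊜ ⊟ b ⊞ (a ⊞ b)) refl _ _)

  ·-mod : ∀ n .{{_ : ℕ.NonZero n}} k x → k · x ≈ toℕ (k mod n) · x + n · (k / n) · x
  ·-mod n k x = trans
    (×-congˡ (≡.trans (m≡m%n+[m/n]*n k n) (≡.cong₂ ℕ._+_
      (≡.sym (Fin.toℕ-fromℕ< (m%n<n k n))) (ℕ.*-comm (k / n) n))))
    (trans (×-homo-+ x (toℕ (k mod n)) (n ℕ.* (k / n))) (+-congˡ (sym (×-assocˡ x n (k / n)))))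

  -- A homomorphism to ℤ/n that sends u to 1 and kills N; `value` states both at once.
  record Character (n : ℕ) .{{_ : ℕ.NonZero n}} (u : Carrier) (N : Pred Carrier p) : Set (c ⊔ ℓ ⊔ p) where
    field
      ρ     : Carrier → Fin n
      cong  : ∀ {x y} → x ≈ y → ρ x ≡ ρ y
      homo  : ∀ x y → ρ (x + y) ≡ AbelianGroup._∙_ (ℤ/ n) (ρ x) (ρ y)
      value : ∀ k {y} → N y → ρ (k · u + y) ≡ k mod n

  module _ (M : Subgroup G p) where

    open Subgroup M

    mem-· : ∀ n {x} → mem x → mem (n · x)
    mem-· zero    _  = mem-ε
    mem-· (suc n) mx = mem-∙ mx (mem-· n mx)

    mem-difference : ∀ {x y z} → mem x → mem y → x ≈ z + y → mem z
    mem-difference mx my eq = mem-resp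
      (modulo eq (solve 3 (λ x y z → x ⊞ ⊟ y ⊞ (z ⊞ y) ⊜ z ⊞ x) refl _ _ _))
      (mem-∙ mx (mem-⁻¹ my))

    module _ (n : ℕ) .{{_ : ℕ.NonZero n}} (u : Carrier) (exponent : ∀ x → mem (n · x)) where

      mem-mod : ∀ k {x g} → mem (x + - (k · g)) → mem (x + - (toℕ (k mod n) · g))
      mem-mod k {x} {g} m = mem-resp
        (modulo (sym (·-mod n k g))
          (solve 4 (λ x k i e → x ⊞ ⊟ k ⊞ e ⊞ k ⊜ x ⊞ ⊟ i ⊞ (i ⊞ e)) refl _ _ _ _))
        (mem-∙ m (exponent ((k / n) · g)))

      -- The hypotheses make the quotient by M cyclic of order n with generator u; ρ x is the
      -- coefficient of u in the class of x.
      character : (∀ x → ∃[ i ] mem (x + - (toℕ {n} i · u))) →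
        (∀ i → mem (toℕ {n} i · u) → toℕ i ≡ 0) → Character n u mem
      character generates faithful = record
        { ρ = ρ
        ; cong = λ {x} {y} x≈y → ≡.trans
            (determined (toℕ (ρ y)) (mem-resp (+-congʳ (sym x≈y)) (proj₂ (generates y))))
            (mod-toℕ (ρ y))
        ; homo = λ x y → determined (toℕ (ρ x) ℕ.+ toℕ (ρ y)) (mem-resp
            (modulo (×-homo-+ u (toℕ (ρ x)) (toℕ (ρ y)))
              (solve 5 (λ x y i j k →
                x ⊞ ⊟ i ⊞ (y ⊞ ⊟ j) ⊞ (i ⊞ j) ⊜ x ⊞ y ⊞ ⊟ k ⊞ k) refl _ _ _ _ _))
            (mem-∙ (proj₂ (generates x)) (proj₂ (generates y))))
        ; value = λ k {y} my → determined k
            (mem-resp (solve 2 (λ k y → y ⊜ k ⊞ y ⊞ ⊟ k) refl _ _) my)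
        }
        where
        ρ : Carrier → Fin n
        ρ x = proj₁ (generates x)

        mod-cong : ∀ {k l} → k % n ≡ l % n → k mod n ≡ l mod n
        mod-cong {k} {l} eq = Fin.fromℕ<-cong _ _ eq (m%n<n k n) (m%n<n l n)

        vanishing : ∀ k → mem (k · u) → k % n ≡ 0
        vanishing k m = ≡.trans (≡.sym (Fin.toℕ-fromℕ< (m%n<n k n))) (faithful (k mod n)
          (mem-difference m (exponent ((k / n) · u)) (·-mod n k u)))

        unique-≤ : ∀ {x k l} → k ≤ l → mem (x + - (k · u)) → mem (x + - (l · u)) → l % n ≡ k % n
        unique-≤ {x} {k} k≤l mk ml with ℕ.m≤n⇒∃[o]m+o≡n k≤l
        ... | d , ≡.refl = ≡.trans (%-distribˡ-+ k d n) (≡.trans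
          (≡.cong (λ e → (k % n ℕ.+ e) % n) (vanishing d (mem-difference mk ml
            (modulo (×-homo-+ u k d)
              (solve 4 (λ x k d e → x ⊞ ⊟ k ⊞ (k ⊞ d) ⊜ d ⊞ (x ⊞ ⊟ e) ⊞ e) refl _ _ _ _)))))
          (≡.trans (≡.cong (_% n) (ℕ.+-identityʳ _)) (m%n%n≡m%n k n)))

        unique : ∀ {x} k l → mem (x + - (k · u)) → mem (x + - (l · u)) → k % n ≡ l % n
        unique k l mk ml with ℕ.≤-total k l
        ... | inj₁ k≤l = ≡.sym (unique-≤ k≤l mk ml)
        ... | inj₂ l≤k = unique-≤ l≤k ml mk

        determined : ∀ {x} k → mem (x + - (k · u)) → ρ x ≡ k mod n
        determined {x} k m = ≡.trans (≡.sym (mod-toℕ (ρ x)))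
          (mod-cong (unique (toℕ (ρ x)) k (proj₂ (generates x)) m))

  -- Subgroups maximal among those avoiding an element

  -- Fixing the lowest universe lets unions of chains and adjunctions of elements, after `Resize`,
  -- stay within this type.
  record Avoiding (N : Pred Carrier p) (t : Carrier) : Set (lsuc 0ℓ ⊔ c ⊔ ℓ ⊔ p) where
    field
      subgroup : Subgroup G 0ℓ
      contains : ∀ {x} → N x → Subgroup.mem subgroup x
      avoids   : ¬ Subgroup.mem subgroup t

    open Subgroup subgroup public using (mem; mem-resp; mem-ε; mem-∙; mem-⁻¹)

  inclusion : Pred Carrier p → Carrier → Preorder _ _ _
  inclusion N t = record
    { Carrier = Avoiding N t
    ; _≈_ = _≡_
    ; _≲_ = λ K M → ∀ {x} → Avoiding.mem K x → Avoiding.mem M x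
    ; isPreorder = record
      { isEquivalence = ≡.isEquivalence
      ; reflexive = λ { ≡.refl m → m }
      ; trans = λ K⊆L L⊆M m → L⊆M (K⊆L m)
      }
    }

  module _ (em : ∀ {a} → ExcludedMiddle a) where

    union : (N : Subgroup G p) {t : Carrier} → ¬ Subgroup.mem N t →
      let P = inclusion (Subgroup.mem N) t in
      (C : Pred (Preorder.Carrier P) 0ℓ) → IsChain P C → ∃[ K ] IsLub P C K
    union N {t} t∉N C chain = record
      { subgroup = record
        { mem      = λ x → Resize em (In x)
        ; mem-resp = λ x≈y → map (in-resp x≈y)
        ; mem-ε    = fromWitness (inj₁ N.mem-ε)
        ; mem-∙    = λ mx my → fromWitness (in-∙ (toWitness mx) (toWitness my))
        ; mem-⁻¹   = map in-⁻¹
        }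
      ; contains = fromWitness ∘ inj₁
      ; avoids   = λ m → [ t∉N , (λ (K , _ , mt) → K.avoids K mt) ]′ (toWitness m)
      }
      , (λ {K} K∈C m → fromWitness (inj₂ (K , K∈C , m)))
      , λ {L} C≤L m → [ K.contains L , (λ (K , K∈C , mx) → C≤L K∈C mx) ]′ (toWitness m)
      where
      module N = Subgroup N
      module K = Avoiding

      -- The disjunct for N provides for the empty chain.
      In : Pred Carrier _
      In x = N.mem x ⊎ ∃[ K ] (C K × K.mem K x)

      map : ∀ {x y} → (In x → In y) → Resize em (In x) → Resize em (In y)
      map f m = fromWitness (f (toWitness m))

      in-resp : ∀ {x y} → x ≈ y → In x → In y
      in-resp x≈y (inj₁ m)           = inj₁ (N.mem-resp x≈y m)
      in-resp x≈y (inj₂ (K , K∈ , m)) = inj₂ (K , K∈ , K.mem-resp K x≈y m)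

      in-⁻¹ : ∀ {x} → In x → In (- x)
      in-⁻¹ (inj₁ m)            = inj₁ (N.mem-⁻¹ m)
      in-⁻¹ (inj₂ (K , K∈ , m)) = inj₂ (K , K∈ , K.mem-⁻¹ K m)

      in-∙ : ∀ {x y} → In x → In y → In (x + y)
      in-∙ (inj₁ m) (inj₁ m′) = inj₁ (N.mem-∙ m m′)
      in-∙ (inj₁ m) (inj₂ (K , K∈ , m′)) = inj₂ (K , K∈ , K.mem-∙ K (K.contains K m) m′)
      in-∙ (inj₂ (K , K∈ , m)) (inj₁ m′) = inj₂ (K , K∈ , K.mem-∙ K m (K.contains K m′))
      in-∙ (inj₂ (K , K∈ , m)) (inj₂ (L , L∈ , m′)) with chain K∈ L∈
      ... | inj₁ K⊆L = inj₂ (L , L∈ , K.mem-∙ L (K⊆L m) m′)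
      ... | inj₂ L⊆K = inj₂ (K , K∈ , K.mem-∙ K m (L⊆K m′))

    module _ (choice : ∀ {a b ℓ₁ ℓ₂} → AxiomOfChoice a b ℓ₁ ℓ₂) where

      -- What maximality is used for: modulo M, t is a multiple of every nonzero element, with a
      -- coefficient below n because n annihilates the quotient.
      record RelativelyMaximal (n : ℕ) .{{_ : ℕ.NonZero n}} (N : Pred Carrier p) (t : Carrier) :
        Set (lsuc 0ℓ ⊔ c ⊔ ℓ ⊔ p) where
        field
          avoiding : Avoiding N t
        open Avoiding avoiding public
        field
          exponent : ∀ x → mem (n · x)
          reaches  : ∀ g → ¬ mem g → ∃[ i ] mem (t + - (toℕ {n} i · g))

      relativelyMaximal : ∀ n {N : Pred Carrier p} {t} → (∀ x → N (suc n · x)) →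
        (M : Avoiding N t) → IsMaximal (inclusion N t) M → RelativelyMaximal (suc n) N t
      relativelyMaximal n {N} {t} exponent-N M maximal = record
        { avoiding = M
        ; exponent = exponent
        ; reaches  = λ g g∉M → decidable-stable em λ none → g∉M
            (maximal {adjoin g none} (λ m → fromWitness (0 , mem-resp
                (solve 1 (λ x → x ⊜ x ⊞ ⊟ 𝟘) refl _) m))
              (fromWitness (1 , mem-resp (solve 1 (λ g → 𝟘 ⊜ g ⊞ ⊟ (g ⊞ 𝟘)) refl g) mem-ε)))
        }
        where
        open Avoiding M

        exponent : ∀ x → mem (suc n · x)
        exponent x = contains (exponent-N x)

        adjoin : ∀ g → ¬ (∃[ i ] mem (t + - (toℕ {suc n} i · g))) → Avoiding N t
        adjoin g none = record
          { subgroup = record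
            { mem = λ x → Resize em (∃[ k ] mem (x + - (k · g)))
            ; mem-resp = λ x≈y m → let k , mk = toWitness m in
                fromWitness (k , mem-resp (+-congʳ x≈y) mk)
            ; mem-ε = fromWitness (0 , mem-resp (solve 0 (𝟘 ⊜ 𝟘 ⊞ ⊟ 𝟘) refl) mem-ε)
            ; mem-∙ = λ m m′ → let (k , mk) , (l , ml) = toWitness m , toWitness m′ in
                fromWitness (k ℕ.+ l , mem-resp
                  (modulo (×-homo-+ g k l)
                    (solve 5 (λ x y k l e →
                      x ⊞ ⊟ k ⊞ (y ⊞ ⊟ l) ⊞ (k ⊞ l) ⊜ x ⊞ y ⊞ ⊟ e ⊞ e) refl _ _ _ _ _))
                  (mem-∙ mk ml))
            -- Coefficients are natural numbers, so - k is replaced by n * k; this works because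
            -- `suc n` annihilates G modulo M.
            ; mem-⁻¹ = λ m → let k , mk = toWitness m in
                fromWitness (n ℕ.* k , mem-resp
                  (modulo (sym (×-assocˡ g n k))
                    (solve 4 (λ x k e e′ →
                      ⊟ (x ⊞ ⊟ k) ⊞ ⊟ (k ⊞ e) ⊞ e ⊜ ⊟ x ⊞ ⊟ e′ ⊞ e′) refl _ _ _ _))
                  (mem-∙ (mem-⁻¹ mk) (mem-⁻¹ (exponent (k · g)))))
            }
          ; contains = λ m → fromWitness (0 , mem-resp
              (solve 1 (λ x → x ⊜ x ⊞ ⊟ 𝟘) refl _) (contains m))
          ; avoids = λ m → let k , mk = toWitness m in
              none (k mod suc n , mem-mod subgroup (suc n) g exponent k mk)
          }

      existsRelativelyMaximal : ∀ n (N : Subgroup G p) {t} → ¬ Subgroup.mem N t →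
        (∀ x → Subgroup.mem N (suc n · x)) → RelativelyMaximal (suc n) (Subgroup.mem N) t
      existsRelativelyMaximal n N {t} t∉N exponent-N =
        let M , maximal = zorn em choice (inclusion (Subgroup.mem N) t) (union N t∉N) in
        relativelyMaximal n exponent-N M λ {K} → maximal {K}

      restrict : ∀ {n u} .{{_ : ℕ.NonZero n}} {N : Pred Carrier p} {M : Pred Carrier a} →
        (∀ {x} → N x → M x) → Character n u M → Character n u N
      restrict N⊆M χ = record { ρ = ρ ; cong = cong ; homo = homo ; value = λ k Ny → value k (N⊆M Ny) }
        where open Character χ

      -- For x outside M, u is 0 or x modulo M, and 0 is excluded. So M has index 2.
      character₂ : ∀ {N : Pred Carrier p} {u} → RelativelyMaximal 2 N u → Character 2 u N
      character₂ {u = u} M = restrict contains (character subgroup 2 u exponent generates faithful)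
        where
        open RelativelyMaximal M

        generates : ∀ x → ∃[ i ] mem (x + - (toℕ {2} i · u))
        generates x with em {P = mem x}
        ... | yes m = zero , mem-resp (solve 1 (λ x → x ⊜ x ⊞ ⊟ 𝟘) refl x) m
        ... | no x∉M with reaches x x∉M
        ...   | zero , m = contradiction (mem-resp (solve 1 (λ u → u ⊞ ⊟ 𝟘 ⊜ u) refl u) m) avoids
        ...   | suc zero , m = suc zero , mem-resp
                  (solve 2 (λ x u → ⊟ (u ⊞ ⊟ (x ⊞ 𝟘)) ⊜ x ⊞ ⊟ (u ⊞ 𝟘)) refl x u) (mem-⁻¹ m)

        faithful : ∀ i → mem (toℕ {2} i · u) → toℕ i ≡ 0
        faithful zero       _ = ≡.refl
        faithful (suc zero) m = contradiction (mem-resp (identityʳ u) m) avoids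

      -- M avoids 2u rather than just u, which gives u order 4 in the quotient. There 2u is the only
      -- element of order 2, so an x with 2x = 2u is u or 3u, and every other x outside M is 2u
      -- itself.
      character₄ : ∀ {N : Pred Carrier p} {u} → RelativelyMaximal 4 N (u + u) → Character 4 u N
      character₄ {u = u} M = restrict contains (character subgroup 4 u exponent generates faithful)
        where
        open RelativelyMaximal M

        2u∉M : ∀ {x} → x ≈ u + u → ¬ mem x
        2u∉M eq m = avoids (mem-resp eq m)

        generates : ∀ x → ∃[ i ] mem (x + - (toℕ {4} i · u))
        generates x with em {P = mem x}
        ... | yes m = zero , mem-resp (solve 1 (λ x → x ⊜ x ⊞ ⊟ 𝟘) refl x) m
        ... | no x∉M with reaches x x∉M
        ...   | zero , m = contradiction m (2u∉M (solve 1 (λ u → u ⊞ u ⊞ ⊟ 𝟘 ⊜ u ⊞ u) refl u))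
        ...   | suc zero , m = suc (suc zero) , mem-resp
                  (solve 2 (λ x u → ⊟ (u ⊞ u ⊞ ⊟ (x ⊞ 𝟘)) ⊜ x ⊞ ⊟ (u ⊞ (u ⊞ 𝟘))) refl x u) (mem-⁻¹ m)
        ...   | suc (suc (suc zero)) , m = suc (suc zero) , mem-resp
                  (solve 2 (λ x u → u ⊞ u ⊞ ⊟ (x ⊞ (x ⊞ (x ⊞ 𝟘))) ⊞ (four x ⊞ ⊟ four u) ⊜
                    x ⊞ ⊟ (u ⊞ (u ⊞ 𝟘))) refl x u)
                  (mem-∙ m (mem-∙ (exponent x) (mem-⁻¹ (exponent u))))
                where
                four : ∀ {n} → Expr n → Expr n
                four e = e ⊞ (e ⊞ (e ⊞ (e ⊞ 𝟘)))
        ...   | suc (suc zero) , m with em {P = mem (x + - u)}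
        ...     | yes m′ = suc zero , mem-resp
                    (solve 2 (λ x u → x ⊞ ⊟ u ⊜ x ⊞ ⊟ (u ⊞ 𝟘)) refl x u) m′
        ...     | no x-u∉M with reaches (x + - u) x-u∉M
        ...       | zero , m′ = contradiction m′ (2u∉M (solve 1 (λ u → u ⊞ u ⊞ ⊟ 𝟘 ⊜ u ⊞ u) refl u))
        ...       | suc zero , m′ = suc (suc (suc zero)) , mem-resp
                      (solve 2 (λ x u → ⊟ (u ⊞ u ⊞ ⊟ (x ⊞ ⊟ u ⊞ 𝟘)) ⊜
                        x ⊞ ⊟ (u ⊞ (u ⊞ (u ⊞ 𝟘)))) refl x u) (mem-⁻¹ m′)
        ...       | suc (suc zero) , m′ = contradiction (mem-∙ m′ (mem-⁻¹ m)) (2u∉M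
                      (solve 2 (λ x u → u ⊞ u ⊞ ⊟ (x ⊞ ⊟ u ⊞ (x ⊞ ⊟ u ⊞ 𝟘)) ⊞
                        ⊟ (u ⊞ u ⊞ ⊟ (x ⊞ (x ⊞ 𝟘))) ⊜ u ⊞ u) refl x u))
        ...       | suc (suc (suc zero)) , m′ = suc (suc (suc zero)) , mem-resp
                      (solve 2 (λ x u →
                        ⊟ (u ⊞ u ⊞ ⊟ (x ⊞ ⊟ u ⊞ (x ⊞ ⊟ u ⊞ (x ⊞ ⊟ u ⊞ 𝟘))) ⊞
                          ⊟ (u ⊞ u ⊞ ⊟ (x ⊞ (x ⊞ 𝟘)))) ⊜
                        x ⊞ ⊟ (u ⊞ (u ⊞ (u ⊞ 𝟘)))) refl x u)
                      (mem-⁻¹ (mem-∙ m′ (mem-⁻¹ m)))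

        faithful : ∀ i → mem (toℕ {4} i · u) → toℕ i ≡ 0
        faithful zero _ = ≡.refl
        faithful (suc zero) m = contradiction (mem-∙ m m)
          (2u∉M (solve 1 (λ u → u ⊞ 𝟘 ⊞ (u ⊞ 𝟘) ⊜ u ⊞ u) refl u))
        faithful (suc (suc zero)) m = contradiction m
          (2u∉M (solve 1 (λ u → u ⊞ (u ⊞ 𝟘) ⊜ u ⊞ u) refl u))
        faithful (suc (suc (suc zero))) m = contradiction (mem-∙ (mem-∙ m m) (mem-⁻¹ (exponent u)))
          (2u∉M (solve 1 (λ u → u ⊞ (u ⊞ (u ⊞ 𝟘)) ⊞ (u ⊞ (u ⊞ (u ⊞ 𝟘))) ⊞
            ⊟ (u ⊞ (u ⊞ (u ⊞ (u ⊞ 𝟘)))) ⊜ u ⊞ u) refl u))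

-- Direct sums from dual characters

module Split (G : AbelianGroup c ℓ)
  {m n} .{{_ : ℕ.NonZero m}} .{{_ : ℕ.NonZero n}} {u w : AbelianGroup.Carrier G}
  {N₁ : Pred (AbelianGroup.Carrier G) p} {N₂ : Pred (AbelianGroup.Carrier G) r}
  (χ₁ : Character G m u N₁) (χ₂ : Character G n w N₂)
  where

  open AbelianGroup G renaming
    ( _∙_ to infixl 6 _+_; ε to 0#; _⁻¹ to infix 8 -_
    ; ∙-cong to +-cong; ∙-congˡ to +-congˡ; ∙-congʳ to +-congʳ; ⁻¹-cong to -‿cong)
  open AbelianGroupSolver G
  open Mult commutativeMonoid
    using (×-homo-+; ×-congˡ; ×-congʳ; ×-assocˡ) renaming (_×_ to infixr 8 _·_)

  module _ {q n} .{{_ : ℕ.NonZero n}} {u : Carrier} {N : Pred Carrier q} (χ : Character G n u N) where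

    open Character χ using (ρ; cong; homo)
    private module ℤ/n = AbelianGroup (ℤ/ n)

    ρ-homomorphism : GroupMorphisms.IsGroupHomomorphism rawGroup ℤ/n.rawGroup ρ
    ρ-homomorphism = groupHomomorphism G (ℤ/ n) cong homo

    open GroupMorphisms.IsGroupHomomorphism ρ-homomorphism using (ε-homo; ⁻¹-homo)

    Kernel : Pred Carrier 0ℓ
    Kernel x = ρ x ≡ ℤ/n.ε

    kernel-∙ : ∀ {x y} → Kernel x → Kernel y → Kernel (x + y)
    kernel-∙ kx ky = ≡.trans (homo _ _) (≡.trans (≡.cong₂ ℤ/n._∙_ kx ky) (ℤ/n.identityˡ ℤ/n.ε))

    kernel-⁻¹ : ∀ {x} → Kernel x → Kernel (- x)
    kernel-⁻¹ kx = ≡.trans (⁻¹-homo _) (≡.trans (≡.cong ℤ/n._⁻¹ kx)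
      (AbelianGroupProperties.ε⁻¹≈ε (ℤ/ n)))

    kernel-difference : ∀ {x y} → ρ x ≡ ρ y → Kernel (x + - y)
    kernel-difference {x} {y} eq = ≡.trans (homo x (- y)) (≡.trans
      (≡.cong₂ ℤ/n._∙_ eq (⁻¹-homo y)) (ℤ/n.inverseʳ (ρ y)))

    kernel-shift : ∀ {x y} → Kernel x → ρ (x + y) ≡ ρ y
    kernel-shift {x} {y} kx = ≡.trans (homo x y)
      (≡.trans (≡.cong (ℤ/n._∙ ρ y) kx) (ℤ/n.identityˡ (ρ y)))

  open Character χ₁ using () renaming (ρ to ρ₁; cong to ρ₁-cong; value to value₁; homo to ρ₁-homo)
  open Character χ₂ using () renaming (ρ to ρ₂; cong to ρ₂-cong; value to value₂; homo to ρ₂-homo)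

  kernel : Subgroup G (c ⊔ ℓ)
  kernel = record
    { mem      = λ x → Lift (c ⊔ ℓ) (Kernel χ₁ x × Kernel χ₂ x)
    ; mem-resp = λ x≈y (lift (k₁ , k₂)) →
        lift (≡.trans (ρ₁-cong (sym x≈y)) k₁ , ≡.trans (ρ₂-cong (sym x≈y)) k₂)
    ; mem-ε    = lift (ε-homo (ρ-homomorphism χ₁) , ε-homo (ρ-homomorphism χ₂))
    ; mem-∙    = λ (lift (k₁ , k₂)) (lift (k₁′ , k₂′)) →
        lift (kernel-∙ χ₁ k₁ k₁′ , kernel-∙ χ₂ k₂ k₂′)
    ; mem-⁻¹   = λ (lift (k₁ , k₂)) → lift (kernel-⁻¹ χ₁ k₁ , kernel-⁻¹ χ₂ k₂)
    }
    where open GroupMorphisms.IsGroupHomomorphism using (ε-homo)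

  module _ (mu≈0 : m · u ≈ 0#) (nw≈0 : n · w ≈ 0#)
    (w∈N₁ : ∀ l → N₁ (l · w)) (u∈N₂ : ∀ k → N₂ (k · u)) where

    private H = Subgroup.abelianGroup kernel

    σ : Fin m → Fin n → Carrier
    σ i j = toℕ i · u + toℕ j · w

    ρ₁σ : ∀ i j → ρ₁ (σ i j) ≡ i
    ρ₁σ i j = ≡.trans (value₁ (toℕ i) (w∈N₁ (toℕ j))) (mod-toℕ i)

    ρ₂σ : ∀ i j → ρ₂ (σ i j) ≡ j
    ρ₂σ i j = ≡.trans (ρ₂-cong (comm _ _)) (≡.trans (value₂ (toℕ j) (u∈N₂ (toℕ i))) (mod-toℕ j))

    wrap : ∀ {n} .{{_ : ℕ.NonZero n}} {x} → n · x ≈ 0# → ∀ k → toℕ (k mod n) · x ≈ k · x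
    wrap {n} {x} nx≈0 k = modulo (+-cong (sym (·-mod G n k x)) (sym multiple))
      (solve 3 (λ i k e → i ⊞ (k ⊞ e) ⊜ k ⊞ (i ⊞ e ⊞ 𝟘)) refl _ _ (n · (k / n) · x))
      where
      multiple : n · (k / n) · x ≈ 0#
      multiple = trans (×-assocˡ x n (k / n)) (trans (×-congˡ (ℕ.*-comm n (k / n)))
        (trans (sym (×-assocˡ x (k / n) n)) (trans (×-congʳ (k / n) nx≈0) (·-zero G (k / n)))))

    σ-homo : ∀ i i′ j j′ →
      σ (AbelianGroup._∙_ (ℤ/ m) i i′) (AbelianGroup._∙_ (ℤ/ n) j j′) ≈ σ i j + σ i′ j′
    σ-homo i i′ j j′ = trans
      (+-cong
        (trans (wrap mu≈0 (toℕ i ℕ.+ toℕ i′)) (×-homo-+ u (toℕ i) (toℕ i′)))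
        (trans (wrap nw≈0 (toℕ j ℕ.+ toℕ j′)) (×-homo-+ w (toℕ j) (toℕ j′))))
      (solve 4 (λ a a′ b b′ → a ⊞ a′ ⊞ (b ⊞ b′) ⊜ a ⊞ b ⊞ (a′ ⊞ b′)) refl _ _ _ _)

    σ-cong : ∀ {i i′ j j′} → i ≡ i′ → j ≡ j′ → σ i j ≈ σ i′ j′
    σ-cong eq₁ eq₂ = reflexive (≡.cong₂ σ eq₁ eq₂)

    -- As σ is an additive section of the pair of characters, this projects G onto the span of u and
    -- w; the common kernel is the other summand.
    retract : Carrier → Carrier
    retract x = σ (ρ₁ x) (ρ₂ x)

    residue : Carrier → AbelianGroup.Carrier H
    residue x = x + - retract x , lift
      ( kernel-difference χ₁ (≡.sym (ρ₁σ (ρ₁ x) (ρ₂ x)))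
      , kernel-difference χ₂ (≡.sym (ρ₂σ (ρ₁ x) (ρ₂ x))))

    splitting : G ≅ H ⊕ ℤ/ m ⊕ ℤ/ n
    splitting = decompose , record
      { isGroupMonomorphism = record
        { isGroupHomomorphism = groupHomomorphism G (H ⊕ ℤ/ m ⊕ ℤ/ n) decompose-cong decompose-homo
        ; injective = λ (eq , eq₁ , eq₂) → modulo (+-cong eq (σ-cong eq₁ eq₂))
            (solve 4 (λ x y s t → x ⊞ (y ⊞ ⊟ t ⊞ t) ⊜ y ⊞ (x ⊞ ⊟ s ⊞ s)) refl _ _ _ _)
        }
      ; surjective = λ (h , i , j) → proj₁ h + σ i j ,
          λ {z} z≈x → D.trans {decompose z} {decompose (proj₁ h + σ i j)} {h , i , j}
            (decompose-cong z≈x) (decompose-σ h i j)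
      }
      where
      module D = AbelianGroup (H ⊕ ℤ/ m ⊕ ℤ/ n)

      decompose : Carrier → D.Carrier
      decompose x = residue x , ρ₁ x , ρ₂ x

      decompose-cong : ∀ {x y} → x ≈ y → decompose x D.≈ decompose y
      decompose-cong x≈y =
        +-cong x≈y (-‿cong (σ-cong (ρ₁-cong x≈y) (ρ₂-cong x≈y))) , ρ₁-cong x≈y , ρ₂-cong x≈y

      decompose-homo : ∀ x y → decompose (x + y) D.≈ decompose x D.∙ decompose y
      decompose-homo x y = modulo
        (sym (trans (σ-cong (ρ₁-homo x y) (ρ₂-homo x y)) (σ-homo (ρ₁ x) (ρ₁ y) (ρ₂ x) (ρ₂ y))))
        (solve 5 (λ x y s t e → x ⊞ y ⊞ ⊟ e ⊞ e ⊜ x ⊞ ⊟ s ⊞ (y ⊞ ⊟ t) ⊞ (s ⊞ t))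
          refl _ _ (retract x) (retract y) _)
        , ρ₁-homo x y , ρ₂-homo x y

      decompose-σ : ∀ h i j → decompose (proj₁ h + σ i j) D.≈ (h , i , j)
      decompose-σ (h , lift (k₁ , k₂)) i j =
        modulo (σ-cong (≡.sym eq₁) (≡.sym eq₂))
          (solve 3 (λ h s t → h ⊞ s ⊞ ⊟ t ⊞ t ⊜ h ⊞ s) refl h (σ i j) _)
        , eq₁ , eq₂
        where
        eq₁ : ρ₁ (h + σ i j) ≡ i
        eq₁ = ≡.trans (kernel-shift χ₁ k₁) (ρ₁σ i j)

        eq₂ : ρ₂ (h + σ i j) ≡ j
        eq₂ = ≡.trans (kernel-shift χ₂ k₂) (ρ₂σ i j)

-- Splitting off ℤ/4 ⊕ ℤ/2 or ℤ/2 ⊕ ℤ/2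

module _ (G : AbelianGroup c ℓ) where

  open AbelianGroup G renaming
    ( _∙_ to infixl 6 _+_; ε to 0#; _⁻¹ to infix 8 -_
    ; ∙-cong to +-cong; ∙-congˡ to +-congˡ; ∙-congʳ to +-congʳ; ⁻¹-cong to -‿cong)
  open AbelianGroupSolver G
  open Mult commutativeMonoid
    using () renaming (_×_ to infixr 8 _·_)

  -- Every m with 0 < m < 8 has a multiple congruent to 4 modulo 8, so mx = 0 and 8x = 0 would give
  -- 4x = 0.
  order-8 : ∀ x → ¬ (x + x) + (x + x) ≈ 0# → ((x + x) + (x + x)) + ((x + x) + (x + x)) ≈ 0# →
    HasOrder G x 8
  order-8 x 4x≉0 8x≈0 = s≤s z≤n , trans
    (solve 1 (λ x → x ⊞ (x ⊞ (x ⊞ (x ⊞ (x ⊞ (x ⊞ (x ⊞ (x ⊞ 𝟘))))))) ⊜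
      x ⊞ x ⊞ (x ⊞ x) ⊞ (x ⊞ x ⊞ (x ⊞ x))) refl x) 8x≈0 ,
    λ m 0<m m<8 mx≈0 → 4x≉0 (annihilates m 0<m m<8 mx≈0)
    where
    twice : ∀ {y} → y ≈ 0# → y + y ≈ 0#
    twice y≈0 = trans (+-cong y≈0 y≈0) (identityˡ 0#)

    annihilates : ∀ m → 0 < m → m < 8 → m · x ≈ 0# → (x + x) + (x + x) ≈ 0#
    annihilates 1 _ _ eq = modulo (twice (twice eq)) (solve 1 (λ x →
      let y = x ⊞ 𝟘; 4y = y ⊞ y ⊞ (y ⊞ y) in x ⊞ x ⊞ (x ⊞ x) ⊞ 𝟘 ⊜ 𝟘 ⊞ 4y) refl x)
    annihilates 2 _ _ eq = modulo (twice eq) (solve 1 (λ x →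
      let y = x ⊞ (x ⊞ 𝟘) in x ⊞ x ⊞ (x ⊞ x) ⊞ 𝟘 ⊜ 𝟘 ⊞ (y ⊞ y)) refl x)
    annihilates 3 _ _ eq = modulo (+-cong (twice (twice eq)) (sym 8x≈0)) (solve 1 (λ x →
      let y = x ⊞ (x ⊞ (x ⊞ 𝟘)); 4x = x ⊞ x ⊞ (x ⊞ x) in
      4x ⊞ (𝟘 ⊞ (4x ⊞ 4x)) ⊜ 𝟘 ⊞ (y ⊞ y ⊞ (y ⊞ y) ⊞ 𝟘)) refl x)
    annihilates 4 _ _ eq = modulo eq (solve 1 (λ x →
      x ⊞ x ⊞ (x ⊞ x) ⊞ 𝟘 ⊜ 𝟘 ⊞ (x ⊞ (x ⊞ (x ⊞ (x ⊞ 𝟘))))) refl x)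
    annihilates 5 _ _ eq = modulo (+-cong (twice (twice eq)) (sym (twice 8x≈0))) (solve 1 (λ x →
      let y = x ⊞ (x ⊞ (x ⊞ (x ⊞ (x ⊞ 𝟘)))); 4x = x ⊞ x ⊞ (x ⊞ x) in
      4x ⊞ (𝟘 ⊞ (4x ⊞ 4x ⊞ (4x ⊞ 4x))) ⊜ 𝟘 ⊞ (y ⊞ y ⊞ (y ⊞ y) ⊞ 𝟘)) refl x)
    annihilates 6 _ _ eq = modulo (+-cong (twice eq) (sym 8x≈0)) (solve 1 (λ x →
      let y = x ⊞ (x ⊞ (x ⊞ (x ⊞ (x ⊞ (x ⊞ 𝟘))))); 4x = x ⊞ x ⊞ (x ⊞ x) in
      4x ⊞ (𝟘 ⊞ (4x ⊞ 4x)) ⊜ 𝟘 ⊞ (y ⊞ y ⊞ 𝟘)) refl x)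
    annihilates 7 _ _ eq = modulo
      (+-cong (twice (twice eq)) (+-cong (sym (twice 8x≈0)) (sym 8x≈0))) (solve 1 (λ x →
      let y = x ⊞ (x ⊞ (x ⊞ (x ⊞ (x ⊞ (x ⊞ (x ⊞ 𝟘)))))); 4x = x ⊞ x ⊞ (x ⊞ x) in
      4x ⊞ (𝟘 ⊞ (4x ⊞ 4x ⊞ (4x ⊞ 4x) ⊞ (4x ⊞ 4x))) ⊜ 𝟘 ⊞ (y ⊞ y ⊞ (y ⊞ y) ⊞ (𝟘 ⊞ 𝟘))) refl x)
    annihilates (suc (suc (suc (suc (suc (suc (suc (suc _)))))))) _
      (s≤s (s≤s (s≤s (s≤s (s≤s (s≤s (s≤s (s≤s ())))))))) _

module _ (G : AbelianGroup c ℓ) where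

  open AbelianGroup G renaming
    ( _∙_ to infixl 6 _+_; ε to 0#; _⁻¹ to infix 8 -_
    ; ∙-cong to +-cong; ∙-congˡ to +-congˡ; ∙-congʳ to +-congʳ; ⁻¹-cong to -‿cong)
  open AbelianGroupSolver G
  open Mult commutativeMonoid
    using (×-congʳ; ×-distrib-+) renaming (_×_ to infixr 8 _·_)

  -- Because 2w lies in nG, the coefficients 0 and 1 of w suffice. The witness z covers both an
  -- involution, with z = 0, and an arbitrary w for n = 2, with z = w.
  nG+⟨w⟩ : ∀ n {w z} → w + w ≈ n · z → Subgroup G (c ⊔ ℓ)
  nG+⟨w⟩ n {w} {z} 2w≈nz = record
    { mem      = In
    ; mem-resp = λ where
        x≈x′ (y , inj₁ eq) → y , inj₁ (trans (sym x≈x′) eq)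
        x≈x′ (y , inj₂ eq) → y , inj₂ (trans (sym x≈x′) eq)
    ; mem-ε    = 0# , inj₁ (sym (·-zero G n))
    ; mem-∙    = in-∙
    ; mem-⁻¹   = in-⁻¹
    }
    where
    In : Pred Carrier _
    In x = ∃[ y ] (x ≈ n · y ⊎ x ≈ n · y + w)

    in-∙ : ∀ {x x′} → In x → In x′ → In (x + x′)
    in-∙ (y , inj₁ eq) (y′ , inj₁ eq′) =
      y + y′ , inj₁ (trans (+-cong eq eq′) (sym (×-distrib-+ y y′ n)))
    in-∙ (y , inj₁ eq) (y′ , inj₂ eq′) = y + y′ , inj₂ (trans (+-cong eq eq′)
      (trans (sym (assoc _ _ _)) (+-congʳ (sym (×-distrib-+ y y′ n)))))
    in-∙ (y , inj₂ eq) (y′ , inj₁ eq′) = y + y′ , inj₂ (trans (+-cong eq eq′) (modulo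
      (sym (×-distrib-+ y y′ n))
      (solve 4 (λ a w b d → a ⊞ w ⊞ b ⊞ d ⊜ d ⊞ w ⊞ (a ⊞ b)) refl _ _ _ _)))
    in-∙ (y , inj₂ eq) (y′ , inj₂ eq′) = y + y′ + z , inj₁ (trans (+-cong eq eq′) (modulo
      (+-cong 2w≈nz (sym (trans (×-distrib-+ (y + y′) z n) (+-congʳ (×-distrib-+ y y′ n)))))
      (solve 5 (λ a w b d e → a ⊞ w ⊞ (b ⊞ w) ⊞ (e ⊞ d) ⊜ d ⊞ (w ⊞ w ⊞ (a ⊞ b ⊞ e)))
        refl _ _ _ _ _)))

    in-⁻¹ : ∀ {x} → In x → In (- x)
    in-⁻¹ (y , inj₁ eq) = - y , inj₁ (trans (-‿cong eq) (sym (·-neg G n y)))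
    in-⁻¹ (y , inj₂ eq) = - (y + z) , inj₂ (trans (-‿cong eq) (modulo
      (+-cong (sym 2w≈nz) (sym (trans (·-neg G n (y + z)) (-‿cong (×-distrib-+ y z n)))))
      (solve 4 (λ a w e d → ⊟ (a ⊞ w) ⊞ (w ⊞ w ⊞ d) ⊜ d ⊞ w ⊞ (e ⊞ ⊟ (a ⊞ e))) refl _ _ _ _)))

  module _ (n : ℕ) {w z} (2w≈nz : w + w ≈ n · z) where

    open Subgroup (nG+⟨w⟩ n 2w≈nz) using (mem)

    n·x∈nG+⟨w⟩ : ∀ x → mem (n · x)
    n·x∈nG+⟨w⟩ x = x , inj₁ refl

    k·w∈nG+⟨w⟩ : ∀ k → mem (k · w)
    k·w∈nG+⟨w⟩ k = mem-· G (nG+⟨w⟩ n 2w≈nz) k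
      (0# , inj₂ (sym (trans (+-congʳ (·-zero G n)) (identityˡ w))))

  double-· : ∀ k {x} → x + x ≈ 0# → k · x + k · x ≈ 0#
  double-· k {x} 2x≈0 =
    trans (sym (×-distrib-+ x x k)) (trans (×-congʳ k 2x≈0) (·-zero G k))

  -- The involution w = u - v spans a direct summand. Besides it, u spans one unless 2u = 4y, and then
  -- the involution u - 2y does, while y has order 8.
  module _ (em : ∀ {a} → ExcludedMiddle a) (choice : ∀ {a b ℓ₁ ℓ₂} → AxiomOfChoice a b ℓ₁ ℓ₂)
    (P : QuarterPair G) where

    open QuarterPair P

    w : Carrier
    w = u + - v

    2w≈0 : w + w ≈ 0#
    2w≈0 = modulo 2u≈2v (solve 2 (λ u v → u ⊞ ⊟ v ⊞ (u ⊞ ⊟ v) ⊞ (v ⊞ v) ⊜ 𝟘 ⊞ (u ⊞ u)) refl _ _)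

    2·x≈0 : ∀ {x} → x + x ≈ 0# → 2 · x ≈ 0#
    2·x≈0 eq = trans (+-congˡ (identityʳ _)) eq

    involution-as-multiple : ∀ n {x} → x + x ≈ 0# → x + x ≈ n · 0#
    involution-as-multiple n eq = trans eq (sym (·-zero G n))

    DoubleIsQuadruple = ∃[ y ] u + u ≈ 4 · y

    SummandZ4Z2 = Σ[ H ∈ Subgroup G (c ⊔ ℓ) ] (G ≅ Subgroup.abelianGroup H ⊕ ℤ/ 4 ⊕ ℤ/ 2)

    SummandZ2Z2 = Σ[ H ∈ Subgroup G (c ⊔ ℓ) ]
      ((G ≅ Subgroup.abelianGroup H ⊕ ℤ/ 2 ⊕ ℤ/ 2) ×
       HasElementOfOrder (Subgroup.abelianGroup H) 8)

    -- χ₁ sends u to 1 and kills w, so its kernel must contain 4G + ⟨w⟩ and avoid 2u; χ₂ sends w to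
    -- 1 and kills u, so its kernel must contain 2G + ⟨u⟩ and avoid w. The assumption excludes 2u =
    -- 4y; all other coincidences contradict independence modulo 2G.
    split-4-2 : ¬ DoubleIsQuadruple → SummandZ4Z2
    split-4-2 2u∉4G = Split.kernel G χ₁ χ₂ , Split.splitting G χ₁ χ₂
      (trans (solve 1 (λ u → u ⊞ (u ⊞ (u ⊞ (u ⊞ 𝟘))) ⊜ u ⊞ u ⊞ (u ⊞ u)) refl u) 4u≈0)
      (2·x≈0 2w≈0) (k·w∈nG+⟨w⟩ 4 N₁-eq) (k·w∈nG+⟨w⟩ 2 N₂-eq)
      where
      N₁-eq = involution-as-multiple 4 2w≈0

      N₂-eq : u + u ≈ 2 · u
      N₂-eq = +-congˡ (sym (identityʳ u))

      2u∉N₁ : ¬ Subgroup.mem (nG+⟨w⟩ 4 N₁-eq) (u + u)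
      2u∉N₁ (y , inj₁ eq) = 2u∉4G (y , eq)
      2u∉N₁ (y , inj₂ eq) = independent (u + - (y + y)) (modulo (sym eq)
        (solve 3 (λ u v y → u ⊞ (u ⊞ u) ⊜ v ⊞ (u ⊞ ⊟ (y ⊞ y) ⊞ (u ⊞ ⊟ (y ⊞ y))) ⊞
          (y ⊞ (y ⊞ (y ⊞ (y ⊞ 𝟘))) ⊞ (u ⊞ ⊟ v))) refl _ _ _))

      w∉N₂ : ¬ Subgroup.mem (nG+⟨w⟩ 2 N₂-eq) w
      w∉N₂ (y , inj₁ eq) = independent y (modulo eq
        (solve 3 (λ u v y → u ⊞ (y ⊞ (y ⊞ 𝟘)) ⊜ v ⊞ (y ⊞ y) ⊞ (u ⊞ ⊟ v)) refl _ _ _))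
      w∉N₂ (y , inj₂ eq) = v-nondouble (- y , modulo (sym eq)
        (solve 3 (λ u v y → v ⊞ (u ⊞ ⊟ v) ⊜ ⊟ y ⊞ ⊟ y ⊞ (y ⊞ (y ⊞ 𝟘) ⊞ u)) refl _ _ _))

      χ₁ = character₄ G em choice
        (existsRelativelyMaximal G em choice 3 (nG+⟨w⟩ 4 N₁-eq) 2u∉N₁ (n·x∈nG+⟨w⟩ 4 N₁-eq))
      χ₂ = character₂ G em choice
        (existsRelativelyMaximal G em choice 1 (nG+⟨w⟩ 2 N₂-eq) w∉N₂ (n·x∈nG+⟨w⟩ 2 N₂-eq))

    -- Modulo 2G, s is u and w is u - v, so s and w inherit the independence of u and v, and both
    -- are involutions.
    split-2-2 : DoubleIsQuadruple → SummandZ2Z2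
    split-2-2 (y , 2u≈4y) = Split.kernel G χ₁ χ₂ ,
      Split.splitting G χ₁ χ₂ (2·x≈0 2s≈0) (2·x≈0 2w≈0)
        (k·w∈nG+⟨w⟩ 2 N₁-eq) (k·w∈nG+⟨w⟩ 2 N₂-eq) ,
      h , order-8 (Subgroup.abelianGroup (Split.kernel G χ₁ χ₂)) h
        (λ 4h≈0 → 2u≉0 (trans 2u≈4y (trans (sym 4h≈4y) 4h≈0)))
        (trans (+-cong 4h≈4y 4h≈4y) (trans (+-cong (sym 2u≈4y) (sym 2u≈4y)) 4u≈0))
      where
      s = u + - (y + y)

      2s≈0 : s + s ≈ 0#
      2s≈0 = modulo 2u≈4y (solve 2 (λ u y →
        u ⊞ ⊟ (y ⊞ y) ⊞ (u ⊞ ⊟ (y ⊞ y)) ⊞ (y ⊞ (y ⊞ (y ⊞ (y ⊞ 𝟘)))) ⊜ 𝟘 ⊞ (u ⊞ u)) refl _ _)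

      N₁-eq = involution-as-multiple 2 2w≈0
      N₂-eq = involution-as-multiple 2 2s≈0

      s∉N₁ : ¬ Subgroup.mem (nG+⟨w⟩ 2 N₁-eq) s
      s∉N₁ (x , inj₁ eq) = u-nondouble (y + x , modulo eq
        (solve 3 (λ u x y → u ⊞ (x ⊞ (x ⊞ 𝟘)) ⊜ y ⊞ x ⊞ (y ⊞ x) ⊞ (u ⊞ ⊟ (y ⊞ y))) refl _ _ _))
      s∉N₁ (x , inj₂ eq) = v-nondouble (y + x , modulo eq
        (solve 4 (λ u v x y → v ⊞ (x ⊞ (x ⊞ 𝟘) ⊞ (u ⊞ ⊟ v)) ⊜
          y ⊞ x ⊞ (y ⊞ x) ⊞ (u ⊞ ⊟ (y ⊞ y))) refl _ _ _ _))

      w∉N₂ : ¬ Subgroup.mem (nG+⟨w⟩ 2 N₂-eq) w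
      w∉N₂ (x , inj₁ eq) = independent x (modulo eq
        (solve 3 (λ u v y → u ⊞ (y ⊞ (y ⊞ 𝟘)) ⊜ v ⊞ (y ⊞ y) ⊞ (u ⊞ ⊟ v)) refl _ _ _))
      w∉N₂ (x , inj₂ eq) = v-nondouble (y + - x , modulo (sym eq)
        (solve 4 (λ u v x y → v ⊞ (u ⊞ ⊟ v) ⊜
          y ⊞ ⊟ x ⊞ (y ⊞ ⊟ x) ⊞ (x ⊞ (x ⊞ 𝟘) ⊞ (u ⊞ ⊟ (y ⊞ y)))) refl _ _ _ _))

      χ₁ = character₂ G em choice
        (existsRelativelyMaximal G em choice 1 (nG+⟨w⟩ 2 N₁-eq) s∉N₁ (n·x∈nG+⟨w⟩ 2 N₁-eq))
      χ₂ = character₂ G em choice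
        (existsRelativelyMaximal G em choice 1 (nG+⟨w⟩ 2 N₂-eq) w∉N₂ (n·x∈nG+⟨w⟩ 2 N₂-eq))

      -- y need not lie in the kernel, but its residue differs from it by multiples of the
      -- involutions s and w, so 4h = 4y = 2u.
      h = Split.residue G χ₁ χ₂ (2·x≈0 2s≈0) (2·x≈0 2w≈0)
        (k·w∈nG+⟨w⟩ 2 N₁-eq) (k·w∈nG+⟨w⟩ 2 N₂-eq) y

      2is≈0 = double-· (toℕ (Character.ρ χ₁ y)) 2s≈0
      2jw≈0 = double-· (toℕ (Character.ρ χ₂ y)) 2w≈0

      4h≈4y : (proj₁ h + proj₁ h) + (proj₁ h + proj₁ h) ≈ 4 · y
      4h≈4y = modulo
        (+-cong (sym (+-cong 2is≈0 2is≈0)) (sym (+-cong 2jw≈0 2jw≈0)))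
        (solve 3 (λ y i j → let h = y ⊞ ⊟ (i ⊞ j) in
          h ⊞ h ⊞ (h ⊞ h) ⊞ (i ⊞ i ⊞ (i ⊞ i) ⊞ (j ⊞ j ⊞ (j ⊞ j))) ⊜
          y ⊞ (y ⊞ (y ⊞ (y ⊞ 𝟘))) ⊞ (𝟘 ⊞ 𝟘 ⊞ (𝟘 ⊞ 𝟘))) refl y _ _)

corollary3p3 :
    (∀ {a} → ExcludedMiddle a) →
    (∀ {a b ℓ₁ ℓ₂} → AxiomOfChoice a b ℓ₁ ℓ₂) →
    ∀ {c ℓ : Level} (G : AbelianGroup c ℓ) →
    let
      [1] = Σ[ S ∈ ConnectionSet G (c ⊔ ℓ) ] (Connected (Cay G S) × ¬ IsCCA G S)
      [2] = Σ[ S ∈ ConnectionSet G (c ⊔ ℓ) ] (Connected (Cay G S) × ¬ IsStronglyCCA G S)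
      [3] = Σ[ H ∈ Subgroup G (c ⊔ ℓ) ]
              ((G ≅ Subgroup.abelianGroup H ⊕ ℤ/ 4 ⊕ ℤ/ 2) ⊎
               ((G ≅ Subgroup.abelianGroup H ⊕ ℤ/ 2 ⊕ ℤ/ 2) ×
                HasElementOfOrder (Subgroup.abelianGroup H) 4))
      [4] = Σ[ H ∈ Subgroup G (c ⊔ ℓ) ]
              ((G ≅ Subgroup.abelianGroup H ⊕ ℤ/ 4 ⊕ ℤ/ 2) ⊎
               ((G ≅ Subgroup.abelianGroup H ⊕ ℤ/ 2 ⊕ ℤ/ 2) ×
                HasElementOfOrder (Subgroup.abelianGroup H) 8))
    in ([1] ⇔ [2]) × ([2] ⇔ [3]) × ([3] ⇔ [4])
corollary3p3 em choice {c} {ℓ} G =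
  -- The equivalences are read off the cycle 1 ⇒ 2 ⇒ 4 ⇒ 3 ⇒ 1.
  mk⇔ 1⇒2 (3⇒1 ∘ 4⇒3 ∘ 2⇒4) , mk⇔ (4⇒3 ∘ 2⇒4) (1⇒2 ∘ 3⇒1) , mk⇔ (2⇒4 ∘ 1⇒2 ∘ 3⇒1) 4⇒3
  where
  Decomposition : ℕ → Set _
  Decomposition n = Σ[ H ∈ Subgroup G (c ⊔ ℓ) ]
    ((G ≅ Subgroup.abelianGroup H ⊕ ℤ/ 4 ⊕ ℤ/ 2) ⊎
     ((G ≅ Subgroup.abelianGroup H ⊕ ℤ/ 2 ⊕ ℤ/ 2) ×
      HasElementOfOrder (Subgroup.abelianGroup H) n))

  NotCCA NotStronglyCCA : Set _
  NotCCA = Σ[ S ∈ ConnectionSet G (c ⊔ ℓ) ] (Connected (Cay G S) × ¬ IsCCA G S)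
  NotStronglyCCA = Σ[ S ∈ ConnectionSet G (c ⊔ ℓ) ] (Connected (Cay G S) × ¬ IsStronglyCCA G S)

  1⇒2 : NotCCA → NotStronglyCCA
  1⇒2 (S , connected , notCCA) = S , connected , λ strong → notCCA λ φ preserving →
    strong φ (Identity.bijection (ConnectionSet.elements S) , preserving)

  2⇒4 : NotStronglyCCA → Decomposition 8
  2⇒4 (S , connected , notStrong) with em {P = QuarterPair G}
  ... | no none = contradiction
    (λ φ permuting → ColourPermutation.affine-without-pair em G S connected φ permuting none)
    notStrong
  ... | yes pair with em {P = DoubleIsQuadruple G em choice pair}
  ...   | yes 2u∈4G = let H , split = split-2-2 G em choice pair 2u∈4G in H , inj₂ split
  ...   | no 2u∉4G  = let H , split = split-4-2 G em choice pair 2u∉4G in H , inj₁ split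

  4⇒3 : Decomposition 8 → Decomposition 4
  4⇒3 (H , inj₁ split)           = H , inj₁ split
  4⇒3 (H , inj₂ (split , order)) = H , inj₂ (split , order-4-from-8 (Subgroup.abelianGroup H) order)

  3⇒1 : Decomposition 4 → NotCCA
  3⇒1 (H , split) = Twist.S G pair , Twist.connected G pair , Twist.notCCA G pair
    where
    dual : (G ≅ Subgroup.abelianGroup H ⊕ ℤ/ 4 ⊕ ℤ/ 2) ⊎
      ((G ≅ Subgroup.abelianGroup H ⊕ ℤ/ 2 ⊕ ℤ/ 2) ×
       HasElementOfOrder (Subgroup.abelianGroup H) 4) → DualPair G
    dual (inj₁ iso)         = DualPair-pull iso (DualPair-4⊕2 (Subgroup.abelianGroup H))
    dual (inj₂ (iso , h))   = DualPair-pull iso (DualPair-2⊕2 (Subgroup.abelianGroup H) h)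
    pair = dual split
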